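{- $t(K(9,4))=\frac{5}{4}$. Moreover, if $S$ is a vertex cut of $K(9,4)$ such that $\frac{|S|}{c(K(9,4)\setminus S)} = \frac{5}{4}$, then $S$ is the complement of a maximum independent set of $K(9,4)$.
   Context: The Kneser graph $K(n,k)$ has as vertices the $k$-element subsets of $[n]=\{1,\dots,n\}$, two vertices adjacent iff the subsets are disjoint. A vertex cut is a set $S$ of vertices whose removal disconnects the graph; $c(G\setminus S)$ is the number of connected components after deleting $S$; the toughness is $t(G)=\min_S |S|/c(G\setminus S)$ over all vertex cuts $S$. -}

module Defs where

open import Data.Nat using (ℕ; _≤_; _*_)
open import Data.Fin using (Fin)
open import Data.Fin.Subset using (Subset; ∣_∣; _∩_) renaming (⊥ to ∅)
open import Data.Bool using (Bool; true; false; not)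
open import Data.Product using (Σ; ∃; _×_; _,_; proj₁)
open import Function.Bundles using (_↔_; _⇔_)
open import Relation.Binary.PropositionalEquality using (_≡_)
open import Relation.Binary.Construct.Closure.ReflexiveTransitive using (Star)
open import Relation.Nullary using (¬_)

KVertex : ℕ → ℕ → Set
KVertex n k = Σ (Subset n) (λ s → ∣ s ∣ ≡ k)

KAdj : {n k : ℕ} → KVertex n k → KVertex n k → Set
KAdj (s , _) (t , _) = s ∩ t ≡ ∅

module GraphNotions {V : Set} (Adj : V → V → Set) where

  VSet : Set
  VSet = V → Bool

  Members : VSet → Set
  Members S = Σ V (λ v → S v ≡ true)

  HasSize : VSet → ℕ → Set
  HasSize S m = Members S ↔ Fin m

  Remaining : VSet → Set
  Remaining S = Σ V (λ v → S v ≡ false)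

  AdjRem : (S : VSet) → Remaining S → Remaining S → Set
  AdjRem S u w = Adj (proj₁ u) (proj₁ w)

  Connected : (S : VSet) → Remaining S → Remaining S → Set
  Connected S = Star (AdjRem S)

  NumComponents : VSet → ℕ → Set
  NumComponents S c =
    Σ (Remaining S → Fin c) λ f →
      ((i : Fin c) → ∃ λ u → f u ≡ i) ×
      ((u w : Remaining S) → (f u ≡ f w) ⇔ Connected S u w)

  -- S is a vertex cut with |S| = m and c(G ∖ S) = c (c ≥ 2: disconnected)
  CutData : VSet → ℕ → ℕ → Set
  CutData S m c = HasSize S m × NumComponents S c × 2 ≤ c

  -- t(G) = p / q : min over vertex cuts S of |S| / c(G ∖ S),
  -- with ratios compared by cross-multiplication.
  ToughnessIs : ℕ → ℕ → Set
  ToughnessIs p q =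
    ((S : VSet) (m c : ℕ) → CutData S m c → p * c ≤ q * m) ×
    (Σ VSet λ S → Σ ℕ λ m → Σ ℕ λ c → CutData S m c × q * m ≡ p * c)

  Independent : VSet → Set
  Independent I = (u v : V) → I u ≡ true → I v ≡ true → ¬ Adj u v

  MaxIndependent : VSet → Set
  MaxIndependent I =
    Independent I × Σ ℕ λ a → HasSize I a ×
      ((J : VSet) (b : ℕ) → Independent J → HasSize J b → b ≤ a)

  IsComplementOf : VSet → VSet → Set
  IsComplementOf S I = (v : V) → S v ≡ not (I v)

{-# OPTIONS --safe #-}

-- Let A be the adjacency matrix of K(9,4), with eigenvalues 5, -4, 3, -2, 1. Since A + 4 is
-- positive semidefinite and A 1 = 5 · 1, 14 (⟨x , A x⟩ + 4 ⟨x , x⟩) ≥ (∑ x)² for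
-- every vector x. If C is a component of size t and D is twice its number of edges, then D is
-- at most t² - t, (t² + 8 t) / 5 (no 4-cycles, no triangles) and 3 t + t² / 63 (spectral gap),
-- while t ≤ 120 because some closed neighbourhood avoids C. Applying the first inequality to
-- x = ∑ γ(C) 1_C, with a weight γ(C) depending only on the size of C, these estimates give
-- ∑ (4 t + 5) ≤ 504 = 4 · 126, strictly unless all components are single vertices; and
-- ∑ t = 126 - |S|.
module Submission where

open import Defs
open import Axiom.UniquenessOfIdentityProofs using (module Decidable⇒UIP)
open import Data.Bool as Bool using (Bool; true; false; not; if_then_else_)
open import Data.Bool.Properties using (not-involutive)
open import Data.Empty using (⊥-elim)
open import Data.Fin as Fin using (Fin; zero; suc)
open import Data.Fin.Properties using (+↔⊎)
open import Data.Fin.Subset using (Subset; ∣_∣; _∩_; ∁) renaming (⊥ to ∅)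
open import Data.Integer
  using (ℤ; -[1+_]; -_; _+_; _-_; _*_; _≤_; _<_; 0ℤ; 1ℤ; +≤+; +<+; Positive; NonNegative; nonNegative)
  renaming (+_ to pos; ∣_∣ to abs)
import Data.Integer.Properties as ℤ
open import Data.Integer.Tactic.RingSolver using (solve-∀)
open import Data.List using (List; []; _∷_; _++_; map; allFin)
open import Data.List.Properties using (map-tabulate)
open import Data.Maybe using (Maybe; just; nothing)
open import Data.Maybe.Properties using (just-injective)
open import Data.Nat as ℕ using (ℕ; zero; suc; _∸_; z≤n; s≤s)
import Data.Nat.Properties as ℕ
open import Data.Product using (Σ; ∃; _×_; _,_; proj₁; proj₂)
open import Data.Sum using (_⊎_; inj₁; inj₂)
open import Data.Sum.Function.Propositional using (_⊎-↔_)
open import Data.Vec using ([]; _∷_)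
open import Function.Bundles using (_↔_; mk↔ₛ′; mk⇔; module Inverse; module Equivalence)
open import Function.Construct.Composition using (_↔-∘_)
open import Function.Construct.Symmetry using (↔-sym)
open import Relation.Binary.Construct.Closure.ReflexiveTransitive using (ε; _◅_)
open import Relation.Binary.PropositionalEquality
  using (_≡_; _≢_; refl; sym; trans; cong; cong₂; subst; subst₂; module ≡-Reasoning)
open import Relation.Nullary using (¬_; yes; no; contradiction; does)

-- No eigenvector is constructed; everything stays in ℤ. A matrix whose entries depend on
-- `∣ u ∩ w ∣` alone is given by five numbers, so `(A + 4)(A - 3)(A + 2)(A - 1) = 4 J` (with `J` the
-- all-ones matrix) is a check of five values. An inequality on the spectrum then becomes a
-- polynomial identity: a multiple of the target plus a multiple of this Hoffman polynomial is a sum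
-- of squares. Optimising the weights turns the first inequality into `∑ t² / (D + 4 t) ≤ 14`, so
-- what each component has to satisfy is `t² / (D + 4 t) ≥ (4 t + 5) / 36`, with equality for a
-- single vertex. In terms of the boundary `5 t - D` this asks for slightly less than `45 / 4` edges
-- when `t` is large, hence the target of 12. The obstacle is a component that is almost the whole
-- graph: the spectral gap gives a boundary of at least `t (126 - t) / 63`, which reaches 12 after
-- rounding up only for `6 ≤ t ≤ 120`.

private variable
  E F : Set
  n k : ℕ

-- Finite sums of integers.

∑ : List E → (E → ℤ) → ℤ
∑ []       f = 0ℤ
∑ (x ∷ xs) f = f x + ∑ xs f

∑-cong : (xs : List E) {f g : E → ℤ} → (∀ x → f x ≡ g x) → ∑ xs f ≡ ∑ xs g
∑-cong []       f≗g = refl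
∑-cong (x ∷ xs) f≗g = cong₂ _+_ (f≗g x) (∑-cong xs f≗g)

∑-mono : (xs : List E) {f g : E → ℤ} → (∀ x → f x ≤ g x) → ∑ xs f ≤ ∑ xs g
∑-mono []       f≤g = ℤ.≤-refl
∑-mono (x ∷ xs) f≤g = ℤ.+-mono-≤ (f≤g x) (∑-mono xs f≤g)

∑-zero : (xs : List E) {f : E → ℤ} → (∀ x → f x ≡ 0ℤ) → ∑ xs f ≡ 0ℤ
∑-zero []       f≗0 = refl
∑-zero (x ∷ xs) f≗0 = cong₂ _+_ (f≗0 x) (∑-zero xs f≗0)

∑-nonneg : (xs : List E) {f : E → ℤ} → (∀ x → 0ℤ ≤ f x) → 0ℤ ≤ ∑ xs f
∑-nonneg xs {f} 0≤f = subst (_≤ ∑ xs f) (∑-zero xs (λ _ → refl)) (∑-mono xs 0≤f)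

interchange : ∀ a b c d → (a + b) + (c + d) ≡ (a + c) + (b + d)
interchange = solve-∀

∑-+ : (xs : List E) (f g : E → ℤ) → ∑ xs (λ x → f x + g x) ≡ ∑ xs f + ∑ xs g
∑-+ []       f g = refl
∑-+ (x ∷ xs) f g =
  trans (cong (f x + g x +_) (∑-+ xs f g)) (interchange (f x) (g x) (∑ xs f) (∑ xs g))

∑-*ˡ : (xs : List E) (c : ℤ) (f : E → ℤ) → ∑ xs (λ x → c * f x) ≡ c * ∑ xs f
∑-*ˡ []       c f = sym (ℤ.*-zeroʳ c)
∑-*ˡ (x ∷ xs) c f =
  trans (cong (c * f x +_) (∑-*ˡ xs c f)) (sym (ℤ.*-distribˡ-+ c (f x) (∑ xs f)))

∑-*ʳ : (xs : List E) (f : E → ℤ) (c : ℤ) → ∑ xs (λ x → f x * c) ≡ ∑ xs f * c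
∑-*ʳ xs f c = trans (∑-cong xs λ x → ℤ.*-comm (f x) c) (trans (∑-*ˡ xs c f) (ℤ.*-comm c _))

∑-swap : (xs : List E) (ys : List F) (f : E → F → ℤ) →
         ∑ xs (λ x → ∑ ys (f x)) ≡ ∑ ys (λ y → ∑ xs (λ x → f x y))
∑-swap []       ys f = sym (∑-zero ys λ _ → refl)
∑-swap (x ∷ xs) ys f =
  trans (cong (∑ ys (f x) +_) (∑-swap xs ys f)) (sym (∑-+ ys (f x) λ y → ∑ xs (λ x → f x y)))

∑-++ : (xs ys : List E) (f : E → ℤ) → ∑ (xs ++ ys) f ≡ ∑ xs f + ∑ ys f
∑-++ []       ys f = sym (ℤ.+-identityˡ _)
∑-++ (x ∷ xs) ys f = trans (cong (f x +_) (∑-++ xs ys f)) (sym (ℤ.+-assoc (f x) _ _))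

∑-map : (h : E → F) (xs : List E) (f : F → ℤ) → ∑ (map h xs) f ≡ ∑ xs (λ x → f (h x))
∑-map h []       f = refl
∑-map h (x ∷ xs) f = cong (f (h x) +_) (∑-map h xs f)

∑-allFin-suc : (f : Fin (suc n) → ℤ) →
               ∑ (allFin (suc n)) f ≡ f zero + ∑ (allFin n) (λ i → f (suc i))
∑-allFin-suc {n} f = cong (f zero +_)
  (trans (cong (λ is → ∑ is f) (sym (map-tabulate (λ i → i) suc))) (∑-map suc (allFin n) f))

∑-single : (i : Fin n) (f : Fin n → ℤ) → (∀ j → j ≢ i → f j ≡ 0ℤ) → ∑ (allFin n) f ≡ f i
∑-single {suc n} zero f f≗0 = trans (∑-allFin-suc f)
  (trans (cong (f zero +_) (∑-zero (allFin n) λ j → f≗0 (suc j) λ ())) (ℤ.+-identityʳ _))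
∑-single {suc n} (suc i) f f≗0 = trans (∑-allFin-suc f)
  (trans (cong₂ _+_ (f≗0 zero λ ()) (∑-single i (λ j → f (suc j)) λ j j≢i → f≗0 (suc j) λ { refl → j≢i refl }))
         (ℤ.+-identityˡ _))

∑-1 : ∀ n → ∑ (allFin n) (λ _ → 1ℤ) ≡ pos n
∑-1 zero    = refl
∑-1 (suc n) = trans (∑-allFin-suc {n} (λ _ → 1ℤ)) (cong (λ t → 1ℤ + t) (∑-1 n))

-- Enumeration of the k-sets, and intersection sizes.

with₀ : KVertex n k → KVertex (suc n) (suc k)
with₀ (s , p) = true ∷ s , cong suc p

without₀ : KVertex n k → KVertex (suc n) k
without₀ (s , p) = false ∷ s , p

vertices : ∀ n k → List (KVertex n k)
vertices zero    zero    = ([] , refl) ∷ []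
vertices zero    (suc k) = []
vertices (suc n) zero    = map without₀ (vertices n zero)
vertices (suc n) (suc k) = map with₀ (vertices n k) ++ map without₀ (vertices n (suc k))

∑-vertices-zero : (f : KVertex (suc n) zero → ℤ) →
                  ∑ (vertices (suc n) zero) f ≡ ∑ (vertices n zero) (λ w → f (without₀ w))
∑-vertices-zero {n} f = ∑-map without₀ (vertices n zero) f

∑-vertices-suc : (f : KVertex (suc n) (suc k) → ℤ) →
                 ∑ (vertices (suc n) (suc k)) f ≡
                 ∑ (vertices n k) (λ w → f (with₀ w)) + ∑ (vertices n (suc k)) (λ w → f (without₀ w))
∑-vertices-suc {n} {k} f = trans (∑-++ (map with₀ (vertices n k)) _ f)
  (cong₂ _+_ (∑-map with₀ (vertices n k) f) (∑-map without₀ (vertices n (suc k)) f))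

δ : ℕ → ℕ → ℤ
δ i j = if i ℕ.≡ᵇ j then 1ℤ else 0ℤ

δ-≢ : ∀ {i j} → i ≢ j → δ i j ≡ 0ℤ
δ-≢ {zero}  {zero}  i≢j = ⊥-elim (i≢j refl)
δ-≢ {zero}  {suc j} i≢j = refl
δ-≢ {suc i} {zero}  i≢j = refl
δ-≢ {suc i} {suc j} i≢j = δ-≢ λ i≡j → i≢j (cong suc i≡j)

∣∩∣≤ˡ : (u w : Subset n) → ∣ u ∩ w ∣ ℕ.≤ ∣ u ∣
∣∩∣≤ˡ []          []          = z≤n
∣∩∣≤ˡ (true ∷ u)  (true ∷ w)  = s≤s (∣∩∣≤ˡ u w)
∣∩∣≤ˡ (true ∷ u)  (false ∷ w) = ℕ.m≤n⇒m≤1+n (∣∩∣≤ˡ u w)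
∣∩∣≤ˡ (false ∷ u) (x ∷ w)     = ∣∩∣≤ˡ u w

∣∩∣≤ʳ : (u w : Subset n) → ∣ u ∩ w ∣ ℕ.≤ ∣ w ∣
∣∩∣≤ʳ []          []          = z≤n
∣∩∣≤ʳ (true ∷ u)  (true ∷ w)  = s≤s (∣∩∣≤ʳ u w)
∣∩∣≤ʳ (true ∷ u)  (false ∷ w) = ∣∩∣≤ʳ u w
∣∩∣≤ʳ (false ∷ u) (true ∷ w)  = ℕ.m≤n⇒m≤1+n (∣∩∣≤ʳ u w)
∣∩∣≤ʳ (false ∷ u) (false ∷ w) = ∣∩∣≤ʳ u w

∣∩∣-comm : (u w : Subset n) → ∣ u ∩ w ∣ ≡ ∣ w ∩ u ∣
∣∩∣-comm []          []          = refl
∣∩∣-comm (true ∷ u)  (true ∷ w)  = cong suc (∣∩∣-comm u w)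
∣∩∣-comm (true ∷ u)  (false ∷ w) = ∣∩∣-comm u w
∣∩∣-comm (false ∷ u) (true ∷ w)  = ∣∩∣-comm u w
∣∩∣-comm (false ∷ u) (false ∷ w) = ∣∩∣-comm u w

∣∩∣-idem : (u : Subset n) → ∣ u ∩ u ∣ ≡ ∣ u ∣
∣∩∣-idem []          = refl
∣∩∣-idem (true ∷ u)  = cong suc (∣∩∣-idem u)
∣∩∣-idem (false ∷ u) = ∣∩∣-idem u

∣∩∣≡0⇒∅ : (u w : Subset n) → ∣ u ∩ w ∣ ≡ 0 → u ∩ w ≡ ∅
∣∩∣≡0⇒∅ []          []          _ = refl
∣∩∣≡0⇒∅ (true ∷ u)  (false ∷ w) p = cong (false ∷_) (∣∩∣≡0⇒∅ u w p)
∣∩∣≡0⇒∅ (false ∷ u) (x ∷ w)     p = cong (false ∷_) (∣∩∣≡0⇒∅ u w p)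

∣∅∣ : ∀ n → ∣ ∅ {n} ∣ ≡ 0
∣∅∣ zero    = refl
∣∅∣ (suc n) = ∣∅∣ n

KVertex-≡ : {u w : KVertex n k} → proj₁ u ≡ proj₁ w → u ≡ w
KVertex-≡ {u = s , p} {w = .s , q} refl = cong (s ,_) (ℕ.≡-irrelevant p q)

_#_ : KVertex n k → KVertex n k → ℕ
u # w = ∣ proj₁ u ∩ proj₁ w ∣

#-≤ : (u w : KVertex n k) → u # w ℕ.≤ k
#-≤ (u , p) (w , _) = subst (∣ u ∩ w ∣ ℕ.≤_) p (∣∩∣≤ˡ u w)

#-refl : (u : KVertex n k) → u # u ≡ k
#-refl (u , p) = trans (∣∩∣-idem u) p

-- Two k-sets meet in `k` points only if they are equal, so the kernel `δ k` is the identity matrix.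
-- This also records that `vertices` lists every vertex exactly once.
∑-δ : (u : KVertex n k) (f : KVertex n k → ℤ) → ∑ (vertices n k) (λ w → δ k (u # w) * f w) ≡ f u
∑-δ {zero} ([] , refl) f = trans (ℤ.+-identityʳ _) (ℤ.*-identityˡ _)
∑-δ {suc n} {suc k} (true ∷ u , refl) f = trans (∑-vertices-suc {n} {k} _)
  (trans (cong₂ _+_ (∑-δ (u , refl) (λ w → f (with₀ w)))
                    (∑-zero (vertices n (suc k)) λ w → cong (_* f (without₀ w)) (δ-≢ (λ e →
                      ℕ.<⇒≢ (s≤s (∣∩∣≤ˡ u (proj₁ w))) (sym e)))))
         (ℤ.+-identityʳ _))
∑-δ {suc n} {zero} (false ∷ u , p) f = trans (∑-vertices-zero {n} _) (∑-δ (u , p) (λ w → f (without₀ w)))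
∑-δ {suc n} {suc k} (false ∷ u , p) f = trans (∑-vertices-suc {n} {k} _)
  (trans (cong₂ _+_ (∑-zero (vertices n k) λ w → cong (_* f (with₀ w)) (δ-≢ (λ e →
                      ℕ.<⇒≢ (s≤s (subst (∣ u ∩ proj₁ w ∣ ℕ.≤_) (proj₂ w) (∣∩∣≤ʳ u (proj₁ w)))) (sym e))))
                    (∑-δ (u , p) (λ w → f (without₀ w))))
         (ℤ.+-identityˡ _))

#≡k⇒≡ : (u w : KVertex n k) → u # w ≡ k → u ≡ w
#≡k⇒≡ (u , p) (w , q) e = KVertex-≡ (go u w (trans e (sym p)) (trans e (sym q)))
  where
  go : ∀ {n} (u w : Subset n) → ∣ u ∩ w ∣ ≡ ∣ u ∣ → ∣ u ∩ w ∣ ≡ ∣ w ∣ → u ≡ w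
  go []          []          _ _ = refl
  go (true ∷ u)  (true ∷ w)  a b = cong (true ∷_) (go u w (ℕ.suc-injective a) (ℕ.suc-injective b))
  go (true ∷ u)  (false ∷ w) a b = ⊥-elim (ℕ.<⇒≢ (s≤s (∣∩∣≤ˡ u w)) a)
  go (false ∷ u) (true ∷ w)  a b = ⊥-elim (ℕ.<⇒≢ (s≤s (∣∩∣≤ʳ u w)) b)
  go (false ∷ u) (false ∷ w) a b = cong (false ∷_) (go u w a b)

-- Sums over the neighbours of a vertex.

∑-disjoint : ∀ n k → (Subset n → Subset n → (ℕ → ℤ) → ℤ)
∑-disjoint n k u v g = ∑ (vertices n k) λ w → δ 0 ∣ u ∩ proj₁ w ∣ * g ∣ proj₁ w ∩ v ∣

-- A k-set disjoint from u lives in the complement of u, which splits into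
-- ∁ u ∩ v and ∁ u ∩ ∁ v; the next three lemmas treat a complement that is
-- too small, exactly of size k, and of size k + 1.
∑-disjoint-none : ∀ n k (u v : Subset n) g → ∣ ∁ u ∩ v ∣ ℕ.+ ∣ ∁ u ∩ ∁ v ∣ ℕ.< k →
                  ∑-disjoint n k u v g ≡ 0ℤ
∑-disjoint-none zero    (suc k) u v g lt = refl
∑-disjoint-none (suc n) (suc k) (true ∷ u) (b ∷ v) g lt = trans (∑-vertices-suc {n} {k} _)
  (cong₂ _+_ (∑-zero (vertices n k) λ _ → refl) (∑-disjoint-none n (suc k) u v g lt))
∑-disjoint-none (suc n) (suc k) (false ∷ u) (true ∷ v) g lt = trans (∑-vertices-suc {n} {k} _)
  (cong₂ _+_ (∑-disjoint-none n k u v (λ i → g (suc i)) (ℕ.≤-pred lt))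
             (∑-disjoint-none n (suc k) u v g (ℕ.<-trans (ℕ.n<1+n _) lt)))
∑-disjoint-none (suc n) (suc k) (false ∷ u) (false ∷ v) g lt = trans (∑-vertices-suc {n} {k} _)
  (cong₂ _+_ (∑-disjoint-none n k u v g (ℕ.≤-pred lt'))
             (∑-disjoint-none n (suc k) u v g (ℕ.<-trans (ℕ.n<1+n _) lt')))
  where lt' = subst (ℕ._< suc k) (ℕ.+-suc _ _) lt

∑-disjoint-full : ∀ n k (u v : Subset n) g → ∣ ∁ u ∩ v ∣ ℕ.+ ∣ ∁ u ∩ ∁ v ∣ ≡ k →
                  ∑-disjoint n k u v g ≡ g ∣ ∁ u ∩ v ∣
∑-disjoint-full zero    zero    [] [] g eq = trans (ℤ.+-identityʳ _) (ℤ.*-identityˡ _)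
∑-disjoint-full (suc n) zero (true ∷ u) (b ∷ v) g eq =
  trans (∑-vertices-zero {n} _) (∑-disjoint-full n zero u v g eq)
∑-disjoint-full (suc n) (suc k) (true ∷ u) (b ∷ v) g eq = trans (∑-vertices-suc {n} {k} _)
  (trans (cong₂ _+_ (∑-zero (vertices n k) λ _ → refl) (∑-disjoint-full n (suc k) u v g eq))
         (ℤ.+-identityˡ _))
∑-disjoint-full (suc n) zero (false ∷ u) (true ∷ v) g ()
∑-disjoint-full (suc n) zero (false ∷ u) (false ∷ v) g eq with () ← trans (sym (ℕ.+-suc _ _)) eq
∑-disjoint-full (suc n) (suc k) (false ∷ u) (true ∷ v) g eq = trans (∑-vertices-suc {n} {k} _)
  (trans (cong₂ _+_ (∑-disjoint-full n k u v (λ i → g (suc i)) (ℕ.suc-injective eq))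
                    (∑-disjoint-none n (suc k) u v g (ℕ.≤-reflexive eq)))
         (ℤ.+-identityʳ _))
∑-disjoint-full (suc n) (suc k) (false ∷ u) (false ∷ v) g eq = trans (∑-vertices-suc {n} {k} _)
  (trans (cong₂ _+_ (∑-disjoint-full n k u v g (ℕ.suc-injective eq'))
                    (∑-disjoint-none n (suc k) u v g (ℕ.≤-reflexive eq')))
         (ℤ.+-identityʳ _))
  where eq' = trans (sym (ℕ.+-suc _ _)) eq

-- Total of `g` over the ways to remove one point from a set with `a` points in `v` and `b` outside,
-- `g` being taken at the number of points left in `v`. For `a = 0` the truncated `a ∸ 1` has
-- coefficient 0.
drop-one : ℕ → ℕ → (ℕ → ℤ) → ℤ
drop-one a b g = pos a * g (a ∸ 1) + pos b * g a

drop-one-sucˡ : ∀ a b g → drop-one a b (λ i → g (suc i)) + g a ≡ drop-one (suc a) b g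
drop-one-sucˡ zero    b g = lem (pos b) (g 1) (g 0)
  where lem : ∀ b x y → (0ℤ + b * x) + y ≡ 1ℤ * y + b * x
        lem = solve-∀
drop-one-sucˡ (suc a) b g = lem (pos (suc a)) (g (suc a)) (pos b * g (suc (suc a)))
  where lem : ∀ a x y → (a * x + y) + x ≡ (1ℤ + a) * x + y
        lem = solve-∀

drop-one-sucʳ : ∀ a b g → drop-one a b g + g a ≡ drop-one a (suc b) g
drop-one-sucʳ a b g = lem (pos a * g (a ∸ 1)) (pos b) (g a)
  where lem : ∀ x b y → (x + b * y) + y ≡ x + (1ℤ + b) * y
        lem = solve-∀

∑-disjoint-one : ∀ n k (u v : Subset n) g → ∣ ∁ u ∩ v ∣ ℕ.+ ∣ ∁ u ∩ ∁ v ∣ ≡ suc k →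
                 ∑-disjoint n k u v g ≡ drop-one ∣ ∁ u ∩ v ∣ ∣ ∁ u ∩ ∁ v ∣ g
∑-disjoint-one zero k [] [] g ()
∑-disjoint-one (suc n) zero (true ∷ u) (b ∷ v) g eq =
  trans (∑-vertices-zero {n} _) (∑-disjoint-one n zero u v g eq)
∑-disjoint-one (suc n) (suc k) (true ∷ u) (b ∷ v) g eq = trans (∑-vertices-suc {n} {k} _)
  (trans (cong₂ _+_ (∑-zero (vertices n k) λ _ → refl) (∑-disjoint-one n (suc k) u v g eq))
         (ℤ.+-identityˡ _))
∑-disjoint-one (suc n) zero (false ∷ u) (true ∷ v) g eq = trans (∑-vertices-zero {n} _)
  (trans (∑-disjoint-full n zero u v g (ℕ.suc-injective eq))
         (trans (sym (ℤ.+-identityˡ _))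
         (trans (cong (_+ g ∣ ∁ u ∩ v ∣) (sym (empty ∣ ∁ u ∩ v ∣ ∣ ∁ u ∩ ∁ v ∣ (λ i → g (suc i)) (ℕ.suc-injective eq))))
                (drop-one-sucˡ ∣ ∁ u ∩ v ∣ ∣ ∁ u ∩ ∁ v ∣ g))))
  where empty : ∀ a b g → a ℕ.+ b ≡ 0 → drop-one a b g ≡ 0ℤ
        empty zero zero g refl = refl
∑-disjoint-one (suc n) zero (false ∷ u) (false ∷ v) g eq = trans (∑-vertices-zero {n} _)
  (trans (∑-disjoint-full n zero u v g eq')
         (trans (sym (ℤ.+-identityˡ _))
         (trans (cong (_+ g ∣ ∁ u ∩ v ∣) (sym (empty ∣ ∁ u ∩ v ∣ ∣ ∁ u ∩ ∁ v ∣ g eq')))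
                (drop-one-sucʳ ∣ ∁ u ∩ v ∣ ∣ ∁ u ∩ ∁ v ∣ g))))
  where empty : ∀ a b g → a ℕ.+ b ≡ 0 → drop-one a b g ≡ 0ℤ
        empty zero zero g refl = refl
        eq' = ℕ.suc-injective (trans (sym (ℕ.+-suc _ _)) eq)
∑-disjoint-one (suc n) (suc k) (false ∷ u) (true ∷ v) g eq = trans (∑-vertices-suc {n} {k} _)
  (trans (cong₂ _+_ (∑-disjoint-one n k u v (λ i → g (suc i)) (ℕ.suc-injective eq))
                    (∑-disjoint-full n (suc k) u v g (ℕ.suc-injective eq)))
         (drop-one-sucˡ ∣ ∁ u ∩ v ∣ ∣ ∁ u ∩ ∁ v ∣ g))
∑-disjoint-one (suc n) (suc k) (false ∷ u) (false ∷ v) g eq = trans (∑-vertices-suc {n} {k} _)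
  (trans (cong₂ _+_ (∑-disjoint-one n k u v g eq')
                    (∑-disjoint-full n (suc k) u v g eq'))
         (drop-one-sucʳ ∣ ∁ u ∩ v ∣ ∣ ∁ u ∩ ∁ v ∣ g))
  where eq' = ℕ.suc-injective (trans (sym (ℕ.+-suc _ _)) eq)

∣∩∣+∣∁∩∣ : (u v : Subset n) → ∣ u ∩ v ∣ ℕ.+ ∣ ∁ u ∩ v ∣ ≡ ∣ v ∣
∣∩∣+∣∁∩∣ []          []          = refl
∣∩∣+∣∁∩∣ (true ∷ u)  (true ∷ v)  = cong suc (∣∩∣+∣∁∩∣ u v)
∣∩∣+∣∁∩∣ (true ∷ u)  (false ∷ v) = ∣∩∣+∣∁∩∣ u v
∣∩∣+∣∁∩∣ (false ∷ u) (true ∷ v)  = trans (ℕ.+-suc _ _) (cong suc (∣∩∣+∣∁∩∣ u v))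
∣∩∣+∣∁∩∣ (false ∷ u) (false ∷ v) = ∣∩∣+∣∁∩∣ u v

∣u∣+∣∁u∣ : (u v : Subset n) → ∣ u ∣ ℕ.+ (∣ ∁ u ∩ v ∣ ℕ.+ ∣ ∁ u ∩ ∁ v ∣) ≡ n
∣u∣+∣∁u∣ []          []          = refl
∣u∣+∣∁u∣ (true ∷ u)  (b ∷ v)     = cong suc (∣u∣+∣∁u∣ u v)
∣u∣+∣∁u∣ (false ∷ u) (true ∷ v)  = trans (ℕ.+-suc _ _) (cong suc (∣u∣+∣∁u∣ u v))
∣u∣+∣∁u∣ (false ∷ u) (false ∷ v) =
  trans (cong (∣ u ∣ ℕ.+_) (ℕ.+-suc _ _)) (trans (ℕ.+-suc _ _) (cong suc (∣u∣+∣∁u∣ u v)))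

-- In K(2k+1, k), multiplying the matrix (g ∣ u ∩ v ∣) by the adjacency matrix gives
-- (step k g ∣ u ∩ v ∣).
step : ℕ → (ℕ → ℤ) → ℕ → ℤ
step k g i = drop-one (k ∸ i) (suc i) g

-- The complement of `u` has `k + 1` points, so a neighbour of `u` omits one of them: `k - i` of
-- these points lie in `v` and `i + 1` do not, where `i = ∣ u ∩ v ∣`. The inductions behind it run
-- over arbitrary subsets, since peeling off a point of the ground set changes the sizes of `u` and
-- `v`.
∑-neighbours : ∀ {n k} → n ≡ k ℕ.+ suc k → (u v : KVertex n k) (g : ℕ → ℤ) →
               ∑ (vertices n k) (λ w → δ 0 (u # w) * g (w # v)) ≡ step k g (u # v)
∑-neighbours {n} {k} n≡ (u , p) (v , q) g =
  trans (∑-disjoint-one n k u v g a+b)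
        (cong₂ (λ a b → drop-one a b g) a≡ (ℕ.+-cancelˡ-≡ ∣ ∁ u ∩ v ∣ _ _
          (trans a+b (sym (trans (ℕ.+-suc _ _)
            (cong suc (trans (ℕ.+-comm ∣ ∁ u ∩ v ∣ _) (trans (∣∩∣+∣∁∩∣ u v) q))))))))
  where
  a+b : ∣ ∁ u ∩ v ∣ ℕ.+ ∣ ∁ u ∩ ∁ v ∣ ≡ suc k
  a+b = ℕ.+-cancelˡ-≡ k _ _ (trans (subst (λ m → m ℕ.+ (∣ ∁ u ∩ v ∣ ℕ.+ ∣ ∁ u ∩ ∁ v ∣) ≡ n) p (∣u∣+∣∁u∣ u v)) n≡)

  a≡ : ∣ ∁ u ∩ v ∣ ≡ k ∸ ∣ u ∩ v ∣
  a≡ = sym (trans (cong (_∸ ∣ u ∩ v ∣) (sym (trans (∣∩∣+∣∁∩∣ u v) q))) (ℕ.m+n∸m≡n ∣ u ∩ v ∣ _))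

-- Matrices on the vertices of K(9,4) that depend on intersection size.

V : Set
V = KVertex 9 4

-- Opaque, lest conversion checking unfold sums into their 126 terms.
opaque
  vs : List V
  vs = vertices 9 4

  ∑-vs-δ : (u : V) (f : V → ℤ) → ∑ vs (λ w → δ 4 (u # w) * f w) ≡ f u
  ∑-vs-δ = ∑-δ

  ∑-vs-neighbours : (u v : V) (g : ℕ → ℤ) →
                    ∑ vs (λ w → δ 0 (u # w) * g (w # v)) ≡ step 4 g (u # v)
  ∑-vs-neighbours = ∑-neighbours refl

  ∑-vs-1 : ∑ vs (λ _ → 1ℤ) ≡ pos 126
  ∑-vs-1 = refl

-- The action of the Bose-Mesner algebra of the Johnson scheme: `g` lists the entries of the matrix
-- by intersection size, and only its values at 0 to 4 matter.
K : (ℕ → ℤ) → (V → ℤ) → V → ℤ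
K g x u = ∑ vs λ w → g (u # w) * x w

A : (V → ℤ) → V → ℤ
A = K (δ 0)

⟨_,_⟩ : (V → ℤ) → (V → ℤ) → ℤ
⟨ x , y ⟩ = ∑ vs λ v → x v * y v

K-cong : ∀ {g g′} (x : V → ℤ) u → (∀ i → i ℕ.≤ 4 → g i ≡ g′ i) → K g x u ≡ K g′ x u
K-cong x u g≗g′ = ∑-cong vs λ w → cong (_* x w) (g≗g′ (u # w) (#-≤ u w))

K-congʳ : ∀ g {x y : V → ℤ} u → (∀ v → x v ≡ y v) → K g x u ≡ K g y u
K-congʳ g u x≗y = ∑-cong vs λ w → cong (g (u # w) *_) (x≗y w)

K-sym : ∀ g x y → ⟨ K g x , y ⟩ ≡ ⟨ x , K g y ⟩
K-sym g x y = trans (∑-cong vs λ u → sym (∑-*ʳ vs _ (y u))) (trans (∑-swap vs vs _)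
  (∑-cong vs λ w → trans (∑-cong vs λ u → trans (cong (λ i → g i * x w * y u) (∣∩∣-comm (proj₁ u) (proj₁ w)))
                                                (lem (g (w # u)) (x w) (y u)))
                         (∑-*ˡ vs (x w) _)))
  where lem : ∀ a b c → a * b * c ≡ b * (a * c)
        lem = solve-∀

A-K : ∀ g x u → A (K g x) u ≡ K (step 4 g) x u
A-K g x u = trans (∑-cong vs λ w → sym (∑-*ˡ vs (δ 0 (u # w)) _)) (trans (∑-swap vs vs _)
  (∑-cong vs λ v → trans (∑-cong vs λ w → sym (ℤ.*-assoc (δ 0 (u # w)) (g (w # v)) (x v)))
    (trans (∑-*ʳ vs _ (x v)) (cong (_* x v) (∑-vs-neighbours u v g)))))

A-regular : ∀ u → ∑ vs (λ w → δ 0 (u # w)) ≡ pos 5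
A-regular u = trans (∑-cong vs λ w → sym (ℤ.*-identityʳ _))
  (trans (∑-vs-neighbours u u (λ _ → 1ℤ)) (cong (step 4 (λ _ → 1ℤ)) (#-refl u)))

∑-A : ∀ x → ∑ vs (A x) ≡ pos 5 * ∑ vs x
∑-A x = trans (∑-swap vs vs _) (trans (∑-cong vs λ w →
    trans (∑-*ʳ vs _ (x w)) (cong (_* x w) (trans (∑-cong vs λ u → cong (δ 0) (∣∩∣-comm (proj₁ u) (proj₁ w))) (A-regular w))))
  (∑-*ˡ vs (pos 5) x))

square-nonneg : ∀ i → 0ℤ ≤ i * i
square-nonneg (pos n) = subst (0ℤ ≤_) (ℤ.pos-* n n) (+≤+ z≤n)
square-nonneg (-[1+ n ]) = +≤+ z≤n

-- Polynomials in the adjacency matrix and the quadratic inequalities.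

Poly : Set
Poly = List ℤ

infixl 6 _⊕_
infixl 7 _⊙_ _⊛_

_⊕_ : Poly → Poly → Poly
[]      ⊕ q       = q
(c ∷ p) ⊕ []      = c ∷ p
(c ∷ p) ⊕ (d ∷ q) = c + d ∷ (p ⊕ q)

_⊙_ : ℤ → Poly → Poly
c ⊙ p = map (c *_) p

_⊛_ : Poly → Poly → Poly
[]      ⊛ q = []
(c ∷ p) ⊛ q = c ⊙ q ⊕ (0ℤ ∷ p ⊛ q)

eval : Poly → ℤ → ℤ
eval []      t = 0ℤ
eval (c ∷ p) t = c + t * eval p t

step^ : ℕ → (ℕ → ℤ) → ℕ → ℤ
step^ zero    g = g
step^ (suc k) g = step 4 (step^ k g)

-- (λ + 4)(λ - 3)(λ + 2)(λ - 1), the Hoffman polynomial up to scaling.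
h : Poly
h = pos 24 ∷ - pos 14 ∷ - pos 13 ∷ pos 2 ∷ pos 1 ∷ []

module _ (x : V → ℤ) where

  s : ℤ
  s = ∑ vs x

  A^ : ℕ → V → ℤ
  A^ zero    = x
  A^ (suc k) = A (A^ k)

  m : ℕ → ℤ
  m k = ⟨ x , A^ k ⟩

  ⟨A^,A^⟩ : ∀ i j → ⟨ A^ i , A^ j ⟩ ≡ m (i ℕ.+ j)
  ⟨A^,A^⟩ zero    j = refl
  ⟨A^,A^⟩ (suc i) j = trans (K-sym (δ 0) (A^ i) (A^ j))
    (trans (⟨A^,A^⟩ i (suc j)) (cong m (ℕ.+-suc i j)))

  ap : Poly → ℕ → V → ℤ
  ap []      k v = 0ℤ
  ap (c ∷ p) k v = c * A^ k v + ap p (suc k) v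

  -- The moment functional `⟨ x , p(A) A^k x ⟩`, with the coefficients of `p` listed from the
  -- constant term. As `A` is symmetric, it takes squares of polynomials to squared norms.
  L : Poly → ℕ → ℤ
  L []      k = 0ℤ
  L (c ∷ p) k = c * m k + L p (suc k)

  L-⊕ : ∀ p q k → L (p ⊕ q) k ≡ L p k + L q k
  L-⊕ []      q       k = sym (ℤ.+-identityˡ _)
  L-⊕ (c ∷ p) []      k = sym (ℤ.+-identityʳ _)
  L-⊕ (c ∷ p) (d ∷ q) k = trans (cong ((c + d) * m k +_) (L-⊕ p q (suc k)))
    (lem c d (m k) (L p (suc k)) (L q (suc k)))
    where lem : ∀ c d e a b → (c + d) * e + (a + b) ≡ (c * e + a) + (d * e + b)
          lem = solve-∀

  L-⊙ : ∀ c p k → L (c ⊙ p) k ≡ c * L p k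
  L-⊙ c []      k = sym (ℤ.*-zeroʳ c)
  L-⊙ c (d ∷ p) k = trans (cong (c * d * m k +_) (L-⊙ c p (suc k))) (lem c d (m k) (L p (suc k)))
    where lem : ∀ c d e a → c * d * e + c * a ≡ c * (d * e + a)
          lem = solve-∀

  ⟨A^,ap⟩ : ∀ i q j → ⟨ A^ i , ap q j ⟩ ≡ L q (i ℕ.+ j)
  ⟨A^,ap⟩ i []      j = ∑-zero vs λ v → ℤ.*-zeroʳ (A^ i v)
  ⟨A^,ap⟩ i (c ∷ q) j = trans (∑-cong vs λ v → lem (A^ i v) c (A^ j v) (ap q (suc j) v))
    (trans (∑-+ vs _ _) (cong₂ _+_ (trans (∑-*ˡ vs c _) (cong (c *_) (⟨A^,A^⟩ i j)))
      (trans (⟨A^,ap⟩ i q (suc j)) (cong (L q) (ℕ.+-suc i j)))))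
    where lem : ∀ a c b d → a * (c * b + d) ≡ c * (a * b) + a * d
          lem = solve-∀

  ⟨ap,ap⟩ : ∀ p i q j → ⟨ ap p i , ap q j ⟩ ≡ L (p ⊛ q) (i ℕ.+ j)
  ⟨ap,ap⟩ []      i q j = ∑-zero vs λ v → refl
  ⟨ap,ap⟩ (c ∷ p) i q j = trans (∑-cong vs λ v → lem c (A^ i v) (ap p (suc i) v) (ap q j v))
    (trans (∑-+ vs _ _) (trans (cong₂ _+_
      (trans (∑-*ˡ vs c _) (trans (cong (c *_) (⟨A^,ap⟩ i q j)) (sym (L-⊙ c q (i ℕ.+ j)))))
      (trans (⟨ap,ap⟩ p (suc i) q j) (sym (ℤ.+-identityˡ _))))
      (sym (L-⊕ (c ⊙ q) (0ℤ ∷ p ⊛ q) (i ℕ.+ j)))))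
    where lem : ∀ c a b d → (c * a + b) * d ≡ c * (a * d) + b * d
          lem = solve-∀

  L-square : ∀ p → 0ℤ ≤ L (p ⊛ p) 0
  L-square p = subst (0ℤ ≤_) (⟨ap,ap⟩ p 0 p 0) (∑-nonneg vs λ v → square-nonneg (ap p 0 v))

  ∑-ap : ∀ p k → ∑ vs (ap p k) ≡ eval p (pos 5) * ∑ vs (A^ k)
  ∑-ap []      k = ∑-zero vs λ _ → refl
  ∑-ap (c ∷ p) k = trans (∑-+ vs _ _) (trans (cong₂ _+_ (∑-*ˡ vs c _)
      (trans (∑-ap p (suc k)) (cong (eval p (pos 5) *_) (∑-A (A^ k)))))
    (lem c (∑ vs (A^ k)) (eval p (pos 5)) (pos 5)))
    where lem : ∀ c a e f → c * a + e * (f * a) ≡ (c + f * e) * a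
          lem = solve-∀

  -- The entries, by intersection size, of `p(A)` times the matrix of `g`; `g = δ 4` gives `p(A)`
  -- itself.
  kernel : Poly → (ℕ → ℤ) → ℕ → ℤ
  kernel []      g i = 0ℤ
  kernel (c ∷ p) g i = c * g i + kernel p (step 4 g) i

  A^-K : ∀ k u → A^ k u ≡ K (step^ k (δ 4)) x u
  A^-K zero    u = sym (∑-vs-δ u x)
  A^-K (suc k) u = trans (K-congʳ (δ 0) u (A^-K k)) (A-K (step^ k (δ 4)) x u)

  ap-K : ∀ p k u → ap p k u ≡ K (kernel p (step^ k (δ 4))) x u
  ap-K []      k u = sym (∑-zero vs λ _ → refl)
  ap-K (c ∷ p) k u = trans (cong₂ _+_ (trans (cong (c *_) (A^-K k u)) (sym (∑-*ˡ vs c _))) (ap-K p (suc k) u))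
    (trans (sym (∑-+ vs _ _)) (∑-cong vs λ w → lem c (step^ k (δ 4) (u # w)) (x w) _))
    where lem : ∀ c g y r → c * (g * y) + r * y ≡ (c * g + r) * y
          lem = solve-∀

  -- The polynomial `h` vanishes at every eigenvalue but 5, and `h(5) = 504 = 4 * 126`, so `h(A)`
  -- has all entries 4. The proof reads this off the five intersection sizes.
  hoffman : ∀ u → ap h 0 u ≡ pos 4 * s
  hoffman u = trans (ap-K h 0 u) (trans (K-cong x u all-four) (∑-*ˡ vs (pos 4) x))
    where
    all-four : ∀ i → i ℕ.≤ 4 → kernel h (δ 4) i ≡ pos 4
    all-four 0 _ = refl
    all-four 1 _ = refl
    all-four 2 _ = refl
    all-four 3 _ = refl
    all-four 4 _ = refl
    all-four (suc (suc (suc (suc (suc _))))) (s≤s (s≤s (s≤s (s≤s ()))))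

  L-hoffman : ∀ k → L (h ⊛ k) 0 ≡ pos 4 * s * (eval k (pos 5) * s)
  L-hoffman k = trans (sym (⟨ap,ap⟩ h 0 k 0)) (trans (∑-cong vs λ u → cong (_* ap k 0 u) (hoffman u))
    (trans (∑-*ˡ vs (pos 4 * s) _) (cong (pos 4 * s *_) (∑-ap k 0))))

  -- Since `h(A) = 4 J`, a multiple `h k` contributes just `4 k(5) s²`, while the squares contribute
  -- something non-negative. In both uses `y` and `z` vanish at 5 and at the root of `p`, where the
  -- inequality is an equality.
  certificate : ∀ (p y z k : Poly) (c e σ r : ℤ) → .{{Positive e}} → .{{NonNegative r}} →
                e * c ⊙ p ⊕ h ⊛ k ≡ z ⊛ z ⊕ r ⊙ (y ⊛ y) → pos 4 * eval k (pos 5) ≡ e * σ →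
                0ℤ ≤ c * L p 0 + σ * (s * s)
  certificate p y z k c e σ r cert k₅ =
    ℤ.*-cancelˡ-≤-pos 0ℤ _ e (subst₂ _≤_ (sym (ℤ.*-zeroʳ e)) value squares)
    where
    squares : 0ℤ ≤ L (z ⊛ z) 0 + r * L (y ⊛ y) 0
    squares = ℤ.+-mono-≤ (L-square z)
      (subst (_≤ r * L (y ⊛ y) 0) (ℤ.*-zeroʳ r) (ℤ.*-monoˡ-≤-nonNeg r (L-square y)))

    lem : ∀ e c a f s κ → e * c * a + f * s * (κ * s) ≡ e * (c * a) + f * κ * (s * s)
    lem = solve-∀

    value : L (z ⊛ z) 0 + r * L (y ⊛ y) 0 ≡ e * (c * L p 0 + σ * (s * s))
    value = begin
      L (z ⊛ z) 0 + r * L (y ⊛ y) 0               ≡⟨ cong (L (z ⊛ z) 0 +_) (L-⊙ r (y ⊛ y) 0) ⟨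
      L (z ⊛ z) 0 + L (r ⊙ (y ⊛ y)) 0             ≡⟨ L-⊕ (z ⊛ z) _ 0 ⟨
      L (z ⊛ z ⊕ r ⊙ (y ⊛ y)) 0                   ≡⟨ cong (λ q → L q 0) cert ⟨
      L (e * c ⊙ p ⊕ h ⊛ k) 0                     ≡⟨ L-⊕ (e * c ⊙ p) _ 0 ⟩
      L (e * c ⊙ p) 0 + L (h ⊛ k) 0               ≡⟨ cong₂ _+_ (L-⊙ (e * c) p 0) (L-hoffman k) ⟩
      e * c * L p 0 + pos 4 * s * (eval k (pos 5) * s)
        ≡⟨ lem e c (L p 0) (pos 4) s (eval k (pos 5)) ⟩
      e * (c * L p 0) + pos 4 * eval k (pos 5) * (s * s)
        ≡⟨ cong (λ t → e * (c * L p 0) + t * (s * s)) k₅ ⟩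
      e * (c * L p 0) + e * σ * (s * s)            ≡⟨ cong (e * (c * L p 0) +_) (ℤ.*-assoc e σ (s * s)) ⟩
      e * (c * L p 0) + e * (σ * (s * s))          ≡⟨ ℤ.*-distribˡ-+ e _ _ ⟨
      e * (c * L p 0 + σ * (s * s))                ∎
      where open ≡-Reasoning

  -- Both certificates come from interpolating the left-hand side at the eigenvalues
  -- -4, 3, -2, 1 of A by the square of the factor y times a positive definite quadratic.
  hoffman-certificate : 0ℤ ≤ pos 14 * L (pos 4 ∷ pos 1 ∷ []) 0 + - 1ℤ * (s * s)
  hoffman-certificate = certificate
    (pos 4 ∷ pos 1 ∷ [])
    (- pos 20 ∷ - pos 1 ∷ pos 1 ∷ [])
    (- pos 460 ∷ - pos 703 ∷ - pos 11 ∷ pos 34 ∷ [])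
    (- pos 23120 ∷ - pos 3060 ∷ pos 1156 ∷ [])
    (pos 14) (pos 38080) (- 1ℤ) (pos 3415) refl refl

  gap-certificate : 0ℤ ≤ pos 63 * L (pos 3 ∷ - pos 1 ∷ []) 0 + 1ℤ * (s * s)
  gap-certificate = certificate
    (pos 3 ∷ - pos 1 ∷ [])
    (pos 15 ∷ - pos 8 ∷ pos 1 ∷ [])
    (pos 101310 ∷ - pos 23942 ∷ - pos 9294 ∷ pos 2006 ∷ [])
    (pos 136187340 ∷ - pos 45335600 ∷ pos 4024036 ∷ [])
    (pos 63) (pos 40440960) 1ℤ (pos 2880540) refl refl

  hoffman-bound : s * s ≤ pos 14 * (m 1 + pos 4 * m 0)
  hoffman-bound = ℤ.0≤i-j⇒j≤i (subst (0ℤ ≤_) (lem (pos 14) (pos 4) (m 0) (m 1) (s * s)) hoffman-certificate)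
    where lem : ∀ c d a b q → c * (d * a + (1ℤ * b + 0ℤ)) + - 1ℤ * q ≡ c * (b + d * a) - q
          lem = solve-∀

  spectral-gap : pos 63 * m 1 ≤ pos 63 * (pos 3 * m 0) + s * s
  spectral-gap = ℤ.0≤i-j⇒j≤i (subst (0ℤ ≤_) (lem (pos 63) (pos 3) (m 0) (m 1) (s * s)) gap-certificate)
    where lem : ∀ c d a b q → c * (d * a + (- 1ℤ * b + 0ℤ)) + 1ℤ * q ≡ c * (d * a) + q - c * b
          lem = solve-∀

  module _ (0≤x : ∀ v → 0ℤ ≤ x v) where

    -- If no entry of `p(A)` exceeds 1, then `p(A)` is dominated entrywise by `J`, and
    -- `⟨ x , J x ⟩ = s²`.
    L≤s² : ∀ p → (∀ i → i ℕ.≤ 4 → kernel p (δ 4) i ≤ 1ℤ) → L p 0 ≤ s * s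
    L≤s² p κ≤1 = subst (_≤ s * s) (⟨A^,ap⟩ 0 p 0) (subst (⟨ x , ap p 0 ⟩ ≤_) (∑-*ʳ vs x s)
      (∑-mono vs λ u → ℤ.*-monoˡ-≤-nonNeg (x u) {{nonNegative (0≤x u)}}
        (subst (_≤ s) (sym (ap-K p 0 u)) (∑-mono vs λ w →
          subst (kernel p (δ 4) (u # w) * x w ≤_) (ℤ.*-identityˡ (x w))
            (ℤ.*-monoʳ-≤-nonNeg (x w) {{nonNegative (0≤x w)}} (κ≤1 (u # w) (#-≤ u w)))))))

    -- The entries of `A + I` are 0 and 1. For the indicator of `t` vertices this reads
    -- `D ≤ t² - t`.
    edges-≤-pairs : m 1 + m 0 ≤ s * s
    edges-≤-pairs = subst (_≤ s * s) (lem (m 0) (m 1)) (L≤s² (pos 1 ∷ pos 1 ∷ []) κ≤1)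
      where
      lem : ∀ a b → 1ℤ * a + (1ℤ * b + 0ℤ) ≡ b + a
      lem = solve-∀
      κ≤1 : ∀ i → i ℕ.≤ 4 → kernel (pos 1 ∷ pos 1 ∷ []) (δ 4) i ≤ 1ℤ
      κ≤1 0 _ = ℤ.≤ᵇ⇒≤ _
      κ≤1 1 _ = ℤ.≤ᵇ⇒≤ _
      κ≤1 2 _ = ℤ.≤ᵇ⇒≤ _
      κ≤1 3 _ = ℤ.≤ᵇ⇒≤ _
      κ≤1 4 _ = ℤ.≤ᵇ⇒≤ _
      κ≤1 (suc (suc (suc (suc (suc _))))) (s≤s (s≤s (s≤s (s≤s ()))))

    -- Two vertices are never both adjacent and joined by a path of length two, and such a
    -- path is unique; this bounds m 1 + m 2, while ⟨ (A - 2) x , (A - 2) x ⟩ ≥ 0 bounds m 1 by m 2.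
    girth-bound : pos 5 * m 1 ≤ s * s + pos 8 * m 0
    girth-bound = ℤ.≤-trans (ℤ.0≤i-j⇒j≤i (subst (0ℤ ≤_) (lem₁ (m 0) (m 1) (m 2)) (L-square (- pos 2 ∷ pos 1 ∷ []))))
      (ℤ.+-monoˡ-≤ (pos 8 * m 0) (L≤s² (- pos 4 ∷ pos 1 ∷ pos 1 ∷ []) κ≤1))
      where
      lem₁ : ∀ a b c → pos 4 * a + (- pos 4 * b + (pos 1 * c + 0ℤ)) ≡
                       (- pos 4 * a + (pos 1 * b + (pos 1 * c + 0ℤ))) + pos 8 * a - pos 5 * b
      lem₁ = solve-∀
      κ≤1 : ∀ i → i ℕ.≤ 4 → kernel (- pos 4 ∷ pos 1 ∷ pos 1 ∷ []) (δ 4) i ≤ 1ℤ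
      κ≤1 0 _ = ℤ.≤ᵇ⇒≤ _
      κ≤1 1 _ = ℤ.≤ᵇ⇒≤ _
      κ≤1 2 _ = ℤ.≤ᵇ⇒≤ _
      κ≤1 3 _ = ℤ.≤ᵇ⇒≤ _
      κ≤1 4 _ = ℤ.≤ᵇ⇒≤ _
      κ≤1 (suc (suc (suc (suc (suc _))))) (s≤s (s≤s (s≤s (s≤s ()))))

-- Integer arithmetic for a single component.

≤-via : ∀ {a b d : ℤ} → b - a ≡ d → 0ℤ ≤ d → a ≤ b
≤-via eq 0≤d = ℤ.0≤i-j⇒j≤i (subst (0ℤ ≤_) (sym eq) 0≤d)

*-bound : ∀ (c d b : ℤ) {D} .{{_ : NonNegative c}} → c * D ≤ b → b < c * (1ℤ + d) → D ≤ d
*-bound c d b {D} cD≤b b<cd =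
  ≤-via (lem d D) (ℤ.i≤j⇒0≤j-i (ℤ.i<j⇒suc[i]≤j (ℤ.*-cancelˡ-<-nonNeg c (ℤ.≤-<-trans cD≤b b<cd))))
  where lem : ∀ d D → d - D ≡ (1ℤ + d) - (1ℤ + D)
        lem = solve-∀

0≤* : ∀ {i j} → 0ℤ ≤ i → 0ℤ ≤ j → 0ℤ ≤ i * j
0≤* {i} {j} 0≤i 0≤j =
  subst (_≤ i * j) (ℤ.*-zeroʳ i) (ℤ.*-monoˡ-≤-nonNeg i {{nonNegative 0≤i}} 0≤j)

-- On a component with t vertices and boundary E, the weight 4 t / (9 t - E) would be optimal;
-- these are 45 times the admissible values 1, 3/5 and 4/9.
γ : ℕ → ℤ
γ 1 = pos 45
γ 2 = pos 27
γ 3 = pos 27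
γ 4 = pos 27
γ _ = pos 20

-- A margin of 1 for every component that is not a single vertex; carried through the summation, it
-- settles the equality case. Components are non-empty, so the value at 0 does not occur.
slack : ℕ → ℤ
slack 1 = 0ℤ
slack _ = 1ℤ

0≤slack : ∀ n → 0ℤ ≤ slack n
0≤slack 0 = +≤+ z≤n
0≤slack 1 = +≤+ z≤n
0≤slack (suc (suc n)) = +≤+ z≤n

slack≤0 : ∀ n → slack n ≤ 0ℤ → n ≡ 1
slack≤0 0 (+≤+ ())
slack≤0 1 p = refl
slack≤0 (suc (suc n)) (+≤+ ())

private
  small-component : ∀ n (d : ℤ) {D} → .{{NonNegative (γ n * γ n)}} → D ≤ d →
          γ n * γ n * (d + pos 4 * pos n) + (pos 900 * (pos 4 * pos n + pos 5) + slack n)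
            ≤ pos 360 * (γ n * pos n) →
          γ n * γ n * (D + pos 4 * pos n) + (pos 900 * (pos 4 * pos n + pos 5) + slack n)
            ≤ pos 360 * (γ n * pos n)
  small-component n d D≤d = ℤ.≤-trans (ℤ.+-monoˡ-≤ (pos 900 * (pos 4 * pos n + pos 5) + slack n)
    (ℤ.*-monoˡ-≤-nonNeg (γ n * γ n) (ℤ.+-monoˡ-≤ (pos 4 * pos n) D≤d)))

  -- Large numerals enter as variables, since ℤ multiplication by a literal unfolds in unary.
  large-component : ∀ (κ g c r n D : ℤ) .{{_ : NonNegative (g * g)}} →
          g * g ≡ pos 4 * κ → c ≡ pos 9 * κ → r * g ≡ pos 72 * κ →
          1ℤ ≤ κ * pos 3 → D ≤ pos 5 * n - pos 12 →
          g * g * (D + pos 4 * n) + (c * (pos 4 * n + pos 5) + 1ℤ) ≤ r * (g * n)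
  large-component κ g c r n D g≡ c≡ r≡ 1≤3κ D≤ = begin
    g * g * (D + pos 4 * n) + (c * (pos 4 * n + pos 5) + 1ℤ)
      ≤⟨ ℤ.+-monoˡ-≤ (c * (pos 4 * n + pos 5) + 1ℤ)
           (ℤ.*-monoˡ-≤-nonNeg (g * g) (ℤ.+-monoˡ-≤ (pos 4 * n) D≤)) ⟩
    g * g * (pos 5 * n - pos 12 + pos 4 * n) + (c * (pos 4 * n + pos 5) + 1ℤ)
      ≡⟨ cong₂ (λ a b → a * (pos 5 * n - pos 12 + pos 4 * n) + (b * (pos 4 * n + pos 5) + 1ℤ)) g≡ c≡ ⟩
    pos 4 * κ * (pos 5 * n - pos 12 + pos 4 * n) + (pos 9 * κ * (pos 4 * n + pos 5) + 1ℤ)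
      -- As `4 * 12 = 9 * 5 + 3`, a boundary of 12 edges leaves exactly `3 κ` to spare.
      ≤⟨ ℤ.+-monoʳ-≤ (pos 4 * κ * (pos 5 * n - pos 12 + pos 4 * n))
           (ℤ.+-monoʳ-≤ (pos 9 * κ * (pos 4 * n + pos 5)) 1≤3κ) ⟩
    pos 4 * κ * (pos 5 * n - pos 12 + pos 4 * n) + (pos 9 * κ * (pos 4 * n + pos 5) + κ * pos 3)
      ≡⟨ lem κ n ⟩
    pos 72 * κ * n ≡⟨ cong (_* n) r≡ ⟨
    r * g * n      ≡⟨ ℤ.*-assoc r g n ⟩
    r * (g * n)    ∎
    where
    open ℤ.≤-Reasoning
    lem : ∀ κ n →
          pos 4 * κ * (pos 5 * n - pos 12 + pos 4 * n) + (pos 9 * κ * (pos 4 * n + pos 5) + κ * pos 3)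
            ≡ pos 72 * κ * n
    lem = solve-∀

  -- From `(n - 6) (120 - n) ≥ 0` follows `n² ≤ 126 n - 720`, so `63 D ≤ 63 * 5 n - 720`. Since
  -- `720 > 63 * 11`, rounding yields 12.
  gap⇒D≤5n-12 : ∀ n D → 6 ℕ.≤ n → n ℕ.≤ 120 → pos 63 * D ≤ pos 63 * (pos 3 * pos n) + pos n * pos n →
         D ≤ pos 5 * pos n - pos 12
  gap⇒D≤5n-12 n D 6≤n n≤120 h = *-bound (pos 63) (pos 5 * pos n - pos 12) (pos 63 * (pos 5 * pos n) - pos 720)
    (ℤ.≤-trans h (≤-via (lem₁ (pos 63) (pos 6) (pos 120) (pos 720) (pos n) refl refl)
       (0≤* (ℤ.i≤j⇒0≤j-i (+≤+ 6≤n)) (ℤ.i≤j⇒0≤j-i (+≤+ n≤120)))))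
    (subst (pos 63 * (pos 5 * pos n) - pos 720 <_) (sym (lem₂ (pos 63) (pos 5 * pos n)))
      (ℤ.+-monoʳ-< (pos 63 * (pos 5 * pos n)) (ℤ.neg-mono-< (+<+ (ℕ.≤ᵇ⇒≤ 694 720 _)))))
    where
    lem₀ : ∀ κ p q n → κ * (pos 5 * n) - p * q - (κ * (pos 3 * n) + n * n) ≡
                       (n - p) * (q - n) + (κ * pos 2 - (p + q)) * n
    lem₀ = solve-∀
    lem₁ : ∀ κ p q r n → r ≡ p * q → κ * pos 2 - (p + q) ≡ 0ℤ →
           κ * (pos 5 * n) - r - (κ * (pos 3 * n) + n * n) ≡ (n - p) * (q - n)
    lem₁ κ p q r n refl e = trans (lem₀ κ p q n)
      (trans (cong (λ z → (n - p) * (q - n) + z * n) e) (ℤ.+-identityʳ _))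
    lem₂ : ∀ κ z → κ * (1ℤ + (z - pos 12)) ≡ κ * z - κ * pos 11
    lem₂ = solve-∀

  D≤n²-n : ∀ n D → D + n ≤ n * n → D ≤ n * n - n
  D≤n²-n n D p = ≤-via (lem n D) (ℤ.i≤j⇒0≤j-i p)
    where lem : ∀ n D → n * n - n - D ≡ n * n - (D + n)
          lem = solve-∀

-- With `g = γ n / 45` the conclusion without slack is `g² (D + 4 n) + (4 / 9) (4 n + 5) ≤ 8 g n`, a
-- linearised form of `n² / (D + 4 n) ≥ (4 n + 5) / 36`. Counting pairs settles sizes up to 3, the
-- girth bound sizes 4 and 5, and the spectral gap the rest; at size 5 the gap would give `D ≤ 15`,
-- where 13 is wanted.
component-bound : ∀ n (D : ℤ) → 1 ℕ.≤ n → n ℕ.≤ 120 →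
  D + pos n ≤ pos n * pos n →
  pos 5 * D ≤ pos n * pos n + pos 8 * pos n →
  pos 63 * D ≤ pos 63 * (pos 3 * pos n) + pos n * pos n →
  γ n * γ n * (D + pos 4 * pos n) + (pos 900 * (pos 4 * pos n + pos 5) + slack n) ≤ pos 360 * (γ n * pos n)
component-bound 1 D _ _ h₁ h₂ h₃ = small-component 1 (pos 0) (D≤n²-n (pos 1) D h₁) (ℤ.≤ᵇ⇒≤ _)
component-bound 2 D _ _ h₁ h₂ h₃ = small-component 2 (pos 2) (D≤n²-n (pos 2) D h₁) (ℤ.≤ᵇ⇒≤ _)
component-bound 3 D _ _ h₁ h₂ h₃ = small-component 3 (pos 6) (D≤n²-n (pos 3) D h₁) (ℤ.≤ᵇ⇒≤ _)
component-bound 4 D _ _ h₁ h₂ h₃ = small-component 4 (pos 9)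
  (*-bound (pos 5) (pos 9) (pos 48) h₂ (+<+ (ℕ.≤ᵇ⇒≤ _ _ _))) (ℤ.≤ᵇ⇒≤ _)
component-bound 5 D _ _ h₁ h₂ h₃ =
  large-component (pos 100) (pos 20) (pos 900) (pos 360) (pos 5) D refl refl refl (ℤ.≤ᵇ⇒≤ _)
    (*-bound (pos 5) (pos 13) (pos 65) h₂ (+<+ (ℕ.≤ᵇ⇒≤ _ _ _)))
component-bound n@(suc (suc (suc (suc (suc (suc _)))))) D _ n≤ h₁ h₂ h₃ =
  large-component (pos 100) (pos 20) (pos 900) (pos 360) (pos n) D refl refl refl (ℤ.≤ᵇ⇒≤ _)
    (gap⇒D≤5n-12 n D (s≤s (s≤s (s≤s (s≤s (s≤s (s≤s z≤n)))))) n≤ h₃)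

-- Indicator vectors of disjoint classes of vertices.

0≤δ : ∀ i j → 0ℤ ≤ δ i j
0≤δ i j with i ℕ.≡ᵇ j
... | true  = +≤+ z≤n
... | false = +≤+ z≤n

∑-term-allFin : ∀ {n} (f : Fin n → ℤ) → (∀ i → 0ℤ ≤ f i) → ∀ i → f i ≤ ∑ (allFin n) f
∑-term-allFin {n} f 0≤f i = subst (_≤ ∑ (allFin n) f)
  (trans (∑-single i at-i off) on) (∑-mono (allFin n) at-i≤f)
  where
  at-i : Fin n → ℤ
  at-i j = if does (j Fin.≟ i) then f j else 0ℤ
  on : at-i i ≡ f i
  on with i Fin.≟ i
  ... | yes _  = refl
  ... | no i≢i = contradiction refl i≢i
  off : ∀ j → j ≢ i → at-i j ≡ 0ℤ
  off j j≢i with j Fin.≟ i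
  ... | yes j≡i = contradiction j≡i j≢i
  ... | no _    = refl
  at-i≤f : ∀ j → at-i j ≤ f j
  at-i≤f j with j Fin.≟ i
  ... | yes _ = ℤ.≤-refl
  ... | no _  = 0≤f j

∑-term : ∀ (f : V → ℤ) → (∀ v → 0ℤ ≤ f v) → ∀ v → f v ≤ ∑ vs f
∑-term f 0≤f v = subst (_≤ ∑ vs f) (∑-vs-δ v f) (∑-mono vs λ w →
  subst (δ 4 (v # w) * f w ≤_) (ℤ.*-identityˡ (f w))
    (ℤ.*-monoʳ-≤-nonNeg (f w) {{nonNegative (0≤f w)}} (δ≤1 (v # w))))
  where
  δ≤1 : ∀ i → δ 4 i ≤ 1ℤ
  δ≤1 i with 4 ℕ.≡ᵇ i
  ... | true  = +≤+ (s≤s z≤n)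
  ... | false = +≤+ z≤n

module _ {c : ℕ} where

  χ : Maybe (Fin c) → Fin c → ℤ
  χ nothing  i = 0ℤ
  χ (just j) i = if does (j Fin.≟ i) then 1ℤ else 0ℤ

  χ-on : ∀ i → χ (just i) i ≡ 1ℤ
  χ-on i with i Fin.≟ i
  ... | yes _  = refl
  ... | no i≢i = contradiction refl i≢i

  χ-off : ∀ {i j} → j ≢ i → χ (just j) i ≡ 0ℤ
  χ-off {i} {j} j≢i with j Fin.≟ i
  ... | yes j≡i = contradiction j≡i j≢i
  ... | no _    = refl

  0≤χ : ∀ a i → 0ℤ ≤ χ a i
  0≤χ nothing  i = +≤+ z≤n
  0≤χ (just j) i with j Fin.≟ i
  ... | yes _ = +≤+ z≤n
  ... | no _  = +≤+ z≤n

  χ-idem : ∀ a i → χ a i * χ a i ≡ χ a i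
  χ-idem nothing  i = refl
  χ-idem (just j) i with j Fin.≟ i
  ... | yes _ = refl
  ... | no _  = refl

  χ-cases : ∀ a i → a ≡ just i ⊎ χ a i ≡ 0ℤ
  χ-cases nothing  i = inj₂ refl
  χ-cases (just j) i with j Fin.≟ i
  ... | yes j≡i = inj₁ (cong just j≡i)
  ... | no _    = inj₂ refl

  val : (Fin c → ℤ) → Maybe (Fin c) → ℤ
  val w nothing  = 0ℤ
  val w (just i) = w i

  val-∑ : ∀ w a → val w a ≡ ∑ (allFin c) λ i → w i * χ a i
  val-∑ w nothing  = sym (∑-zero (allFin c) λ i → ℤ.*-zeroʳ (w i))
  val-∑ w (just i) = sym (trans
    (∑-single i _ λ j j≢i → trans (cong (w j *_) (χ-off λ i≡j → j≢i (sym i≡j))) (ℤ.*-zeroʳ (w j)))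
    (trans (cong (w i *_) (χ-on i)) (ℤ.*-identityʳ (w i))))

  -- Here `e` is a matrix entry that vanishes between different classes. No cross terms survive, so
  -- the quadratic form of a weighted sum of indicators splits into one term per class.
  val-product : ∀ w a b e → (∀ i j → a ≡ just i → b ≡ just j → i ≢ j → e ≡ 0ℤ) →
    val w a * (e * val w b) ≡ ∑ (allFin c) λ i → w i * w i * (χ a i * (e * χ b i))
  val-product w nothing  b e h = sym (∑-zero (allFin c) λ i → ℤ.*-zeroʳ (w i * w i))
  val-product w (just i) b e h = sym (trans (∑-single i _ off) (on b h))
    where
    off : ∀ j → j ≢ i → w j * w j * (χ (just i) j * (e * χ b j)) ≡ 0ℤ
    off j j≢i = trans (cong (λ t → w j * w j * (t * (e * χ b j))) (χ-off λ i≡j → j≢i (sym i≡j)))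
                      (ℤ.*-zeroʳ (w j * w j))
    lem₀ : ∀ a x e → a * a * (x * (e * 0ℤ)) ≡ a * (e * 0ℤ)
    lem₀ = solve-∀
    lem₁ : ∀ a e → a * a * (1ℤ * (e * 1ℤ)) ≡ a * (e * a)
    lem₁ = solve-∀
    lem₂ : ∀ a x b → a * a * (x * (0ℤ * b)) ≡ 0ℤ
    lem₂ = solve-∀
    on : ∀ b → (∀ i′ j → just i ≡ just i′ → b ≡ just j → i′ ≢ j → e ≡ 0ℤ) →
         w i * w i * (χ (just i) i * (e * χ b i)) ≡ w i * (e * val w b)
    on nothing  h = lem₀ (w i) (χ (just i) i) e
    on (just j) h with i Fin.≟ j
    ... | yes refl = trans (cong₂ (λ x y → w i * w i * (x * (e * y))) (χ-on i) (χ-on i)) (lem₁ (w i) e)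
    ... | no i≢j with refl ← h i j refl refl i≢j =
      trans (lem₂ (w i) (χ (just i) i) (χ (just j) i)) (sym (ℤ.*-zeroʳ (w i)))

-- (s - e)² ≥ 0 linearises the Hoffman bound.
linearise : ∀ (a b e q w s : ℤ) .{{_ : NonNegative a}} → a * b ≡ pos 2 * e →
            s * s ≤ a * q → q + w ≤ b * s → a * w ≤ e * e
linearise a b e q w s ab≡2e ss≤aq qw≤bs = ≤-via
  (trans (lem a b e q w s)
    (cong (λ z → (s - e) * (s - e) + (a * (b * s - (q + w)) + (a * q - s * s)) + (pos 2 * e - z) * s) ab≡2e))
  (subst (0ℤ ≤_) (lem′ _ (pos 2 * e) s) (ℤ.+-mono-≤ (square-nonneg (s - e)) (ℤ.+-mono-≤
    (0≤* (ℤ.nonNegative⁻¹ a) (ℤ.i≤j⇒0≤j-i qw≤bs)) (ℤ.i≤j⇒0≤j-i ss≤aq))))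
  where
  lem : ∀ a b e q w s → e * e - a * w ≡
    (s - e) * (s - e) + (a * (b * s - (q + w)) + (a * q - s * s)) + (pos 2 * e - a * b) * s
  lem = solve-∀
  lem′ : ∀ x z s → x ≡ x + (z - z) * s
  lem′ = solve-∀

-- The counting bound, for a labelling constant along edges; `nothing` marks deleted vertices.

module Labelled {c : ℕ} (label : V → Maybe (Fin c))
  (separated : ∀ u w i j → u # w ≡ 0 → label u ≡ just i → label w ≡ just j → i ≡ j)
  (onto : ∀ i → ∃ λ v → label v ≡ just i) (2≤c : 2 ℕ.≤ c) where

  component : Fin c → V → ℤ
  component i v = χ (label v) i

  0≤component : ∀ i v → 0ℤ ≤ component i v
  0≤component i v = 0≤χ (label v) i

  t : Fin c → ℤ
  t i = s (component i)

  -- `γ` and `slack` branch on a natural number, whereas the sums live in ℤ.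
  size : Fin c → ℕ
  size i = abs (t i)

  size≡ : ∀ i → pos (size i) ≡ t i
  size≡ i = ℤ.0≤i⇒+∣i∣≡i (∑-nonneg vs (0≤component i))

  m₀≡ : ∀ i → m (component i) 0 ≡ t i
  m₀≡ i = ∑-cong vs λ v → χ-idem (label v) i

  1≤size : ∀ i → 1 ℕ.≤ size i
  1≤size i with v , v∈i ← onto i = ℤ.drop‿+≤+ (subst₂ _≤_
    (trans (cong (λ a → χ a i) v∈i) (χ-on i)) (sym (size≡ i)) (∑-term (component i) (0≤component i) v))

  other : ∀ i → ∃ λ j → j ≢ i
  other i = go c 2≤c i
    where
    go : ∀ c → 2 ℕ.≤ c → (i : Fin c) → ∃ λ j → j ≢ i
    go (suc (suc _)) _ zero    = suc zero , λ ()
    go (suc (suc _)) _ (suc i) = zero , λ ()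
    go (suc zero) (s≤s ()) i

  -- The closed neighbourhood of a vertex in another component misses component i.
  size≤120 : ∀ i → size i ℕ.≤ 120
  size≤120 i with j , j≢i ← other i with v , v∈j ← onto j =
    ℕ.+-cancelˡ-≤ 6 _ _ (ℤ.drop‿+≤+ (subst (_≤ pos 126) (cong (pos 6 +_) (sym (size≡ i)))
      (subst₂ _≤_ total ∑-vs-1 (∑-mono vs pointwise))))
    where
    total : ∑ vs (λ w → δ 0 (v # w) + δ 4 (v # w) + component i w) ≡ pos 6 + t i
    total = trans (∑-+ vs _ _) (cong (_+ t i) (trans (∑-+ vs _ _)
      (cong₂ _+_ (A-regular v) (trans (∑-cong vs λ w → sym (ℤ.*-identityʳ _)) (∑-vs-δ v (λ _ → 1ℤ))))))
    δ₀+δ₄≤1 : ∀ k → δ 0 k + δ 4 k + 0ℤ ≤ 1ℤ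
    δ₀+δ₄≤1 0 = ℤ.≤-refl
    δ₀+δ₄≤1 1 = +≤+ z≤n
    δ₀+δ₄≤1 2 = +≤+ z≤n
    δ₀+δ₄≤1 3 = +≤+ z≤n
    δ₀+δ₄≤1 4 = ℤ.≤-refl
    δ₀+δ₄≤1 (suc (suc (suc (suc (suc k))))) = +≤+ z≤n
    pointwise : ∀ w → δ 0 (v # w) + δ 4 (v # w) + component i w ≤ 1ℤ
    pointwise w with χ-cases (label w) i
    ... | inj₂ ≡0 = subst (λ z → δ 0 (v # w) + δ 4 (v # w) + z ≤ 1ℤ) (sym ≡0) (δ₀+δ₄≤1 (v # w))
    ... | inj₁ w∈i = ℤ.≤-reflexive (cong₂ _+_ (cong₂ _+_
      (δ-≢ λ 0≡ → j≢i (separated v w j i (sym 0≡) v∈j w∈i))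
      (δ-≢ λ 4≡ → j≢i (just-injective (trans (sym v∈j) (trans (cong label (#≡k⇒≡ v w (sym 4≡))) w∈i)))))
      (trans (cong (λ a → χ a i) w∈i) (χ-on i)))

  weight : Fin c → ℤ
  weight i = γ (size i)

  X : V → ℤ
  X v = val weight (label v)

  s-X : s X ≡ ∑ (allFin c) λ i → weight i * t i
  s-X = trans (∑-cong vs λ v → val-∑ weight (label v)) (trans (∑-swap vs (allFin c) _)
    (∑-cong (allFin c) λ i → ∑-*ˡ vs (weight i) (component i)))

  m₁-X : m X 1 ≡ ∑ (allFin c) λ i → weight i * weight i * m (component i) 1
  m₁-X = begin
    m X 1
      ≡⟨ ∑-cong vs (λ v → sym (∑-*ˡ vs (X v) _)) ⟩
    ∑ vs (λ v → ∑ vs λ u → X v * (δ 0 (v # u) * X u))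
      ≡⟨ ∑-cong vs (λ v → ∑-cong vs λ u →
           val-product weight (label v) (label u) (δ 0 (v # u)) (apart v u)) ⟩
    ∑ vs (λ v → ∑ vs λ u → ∑ (allFin c) λ i → term i v u)
      ≡⟨ ∑-cong vs (λ v → ∑-swap vs (allFin c) _) ⟩
    ∑ vs (λ v → ∑ (allFin c) λ i → ∑ vs λ u → term i v u)
      ≡⟨ ∑-swap vs (allFin c) _ ⟩
    ∑ (allFin c) (λ i → ∑ vs λ v → ∑ vs λ u → term i v u)
      ≡⟨ ∑-cong (allFin c) (λ i → trans
           (∑-cong vs λ v → trans (∑-*ˡ vs (weight i * weight i) _)
             (cong (weight i * weight i *_) (∑-*ˡ vs (component i v) _)))
           (∑-*ˡ vs (weight i * weight i) _)) ⟩
    ∑ (allFin c) (λ i → weight i * weight i * m (component i) 1)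
      ∎
    where
    open ≡-Reasoning
    term : Fin c → V → V → ℤ
    term i v u = weight i * weight i * (component i v * (δ 0 (v # u) * component i u))
    apart : ∀ v u i j → label v ≡ just i → label u ≡ just j → i ≢ j → δ 0 (v # u) ≡ 0ℤ
    apart v u i j v∈i u∈j i≢j = δ-≢ λ 0≡ → i≢j (separated v u i j (sym 0≡) v∈i u∈j)

  m₀-X : m X 0 ≡ ∑ (allFin c) λ i → weight i * weight i * t i
  m₀-X = trans (∑-cong vs λ v → trans (cong (X v *_) (sym (ℤ.*-identityˡ (X v)))) (trans
      (val-product weight (label v) (label v) 1ℤ λ i j p q i≢j →
        contradiction (just-injective (trans (sym p) q)) i≢j)
      (∑-cong (allFin c) λ i → cong (weight i * weight i *_)
        (trans (cong (component i v *_) (ℤ.*-identityˡ _)) (χ-idem (label v) i)))))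
    (trans (∑-swap vs (allFin c) _) (∑-cong (allFin c) λ i → ∑-*ˡ vs (weight i * weight i) (component i)))

  D : Fin c → ℤ
  D i = m (component i) 1

  T : ℤ
  T = ∑ (allFin c) t

  excess : ℤ
  excess = ∑ (allFin c) λ i → slack (size i)

  componentwise : ∀ i →
    weight i * weight i * (D i + pos 4 * t i) + (pos 900 * (pos 4 * t i + pos 5) + slack (size i))
      ≤ pos 360 * (weight i * t i)
  componentwise i = bound (size≡ i)
    (subst (λ a → D i + a ≤ t i * t i) (m₀≡ i) (edges-≤-pairs x (0≤component i)))
    (subst (λ a → pos 5 * D i ≤ t i * t i + pos 8 * a) (m₀≡ i) (girth-bound x (0≤component i)))
    (subst (λ a → pos 63 * D i ≤ pos 63 * (pos 3 * a) + t i * t i) (m₀≡ i) (spectral-gap x))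
    where
    x : V → ℤ
    x = component i
    bound : ∀ {τ} → pos (size i) ≡ τ →
      D i + τ ≤ τ * τ →
      pos 5 * D i ≤ τ * τ + pos 8 * τ →
      pos 63 * D i ≤ pos 63 * (pos 3 * τ) + τ * τ →
      weight i * weight i * (D i + pos 4 * τ) + (pos 900 * (pos 4 * τ + pos 5) + slack (size i))
        ≤ pos 360 * (weight i * τ)
    bound refl = component-bound (size i) (D i) (1≤size i) (size≤120 i)

  summed : (m X 1 + pos 4 * m X 0) + (pos 900 * (pos 4 * T + pos 5 * pos c) + excess) ≤ pos 360 * s X
  summed = subst₂ _≤_
    (trans (∑-+ Is _ _) (cong₂ _+_
      (trans (∑-cong Is λ i → distr (weight i * weight i) (D i) (pos 4) (t i))
        (trans (∑-+ Is _ _) (cong₂ _+_ (sym m₁-X) (trans (∑-*ˡ Is (pos 4) _) (cong (pos 4 *_) (sym m₀-X))))))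
      (trans (∑-+ Is _ _) (cong (_+ excess) (trans (∑-*ˡ Is (pos 900) _) (cong (pos 900 *_)
        (trans (∑-+ Is _ _) (cong₂ _+_ (∑-*ˡ Is (pos 4) t)
          (trans (∑-*ˡ Is (pos 5) (λ _ → 1ℤ)) (cong (pos 5 *_) (∑-1 c)))))))))))
    (trans (∑-*ˡ Is (pos 360) _) (cong (pos 360 *_) (sym s-X)))
    (∑-mono Is componentwise)
    where
    Is = allFin c
    distr : ∀ a d f t → a * (d + f * t) ≡ a * d + f * (a * t)
    distr = solve-∀

  weighted-count : pos 900 * (pos 4 * T + pos 5 * pos c) + excess ≤ pos 900 * pos 504
  weighted-count = ℤ.*-cancelˡ-≤-pos _ _ (pos 14)
    -- `2520 = 56 * 45` is the value of `s X` in the extremal case of 56 single vertices, so the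
    -- linearisation is tight there. Moreover `14 * 360 = 2 * 2520` and `2520² = 14 * 900 * 504`.
    (linearise (pos 14) (pos 360) (pos 2520) _ _ (s X) refl (hoffman-bound X) summed)

  0≤excess : 0ℤ ≤ excess
  0≤excess = ∑-nonneg (allFin c) λ i → 0≤slack (size i)

  count-bound : pos 4 * T + pos 5 * pos c ≤ pos 504
  count-bound = ℤ.*-cancelˡ-≤-pos _ _ (pos 900)
    (ℤ.≤-trans (ℤ.i≤i+j (pos 900 * (pos 4 * T + pos 5 * pos c)) excess {{nonNegative 0≤excess}}) weighted-count)

  -- Equality leaves no room for `excess`, a sum of non-negative slacks, so every slack is 0.
  tight⇒singletons : pos 4 * T + pos 5 * pos c ≡ pos 504 → ∀ i → t i ≡ 1ℤ
  tight⇒singletons tight i = trans (sym (size≡ i)) (cong pos (slack≤0 (size i)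
    (ℤ.≤-trans (∑-term-allFin _ (λ j → 0≤slack (size j)) i)
      (cancel (pos 900) (pos 504) excess
        (subst (λ z → pos 900 * z + excess ≤ pos 900 * pos 504) tight weighted-count)))))
    where
    cancel : ∀ k z e → k * z + e ≤ k * z → e ≤ 0ℤ
    cancel k z e p = ≤-via (lem (k * z) e) (ℤ.i≤j⇒0≤j-i p)
      where lem : ∀ y e → 0ℤ - e ≡ y - (y + e)
            lem = solve-∀

-- From vertex cuts to labellings: the toughness bound and the equality case.

module OddGraph where

  open GraphNotions (KAdj {9} {4})

  ⟦_⟧ : Bool → ℤ
  ⟦ b ⟧ = if b then 1ℤ else 0ℤ

  Bool-irrelevant : {a b : Bool} (p q : a ≡ b) → p ≡ q
  Bool-irrelevant = Decidable⇒UIP.≡-irrelevant Bool._≟_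

  KAdj⇒#≡0 : (u w : V) → KAdj u w → u # w ≡ 0
  KAdj⇒#≡0 u w adj = trans (cong ∣_∣ adj) (∣∅∣ 9)

  fibre-≡ : ∀ {S : VSet} {b} {x y : Σ V λ v → S v ≡ b} → proj₁ x ≡ proj₁ y → x ≡ y
  fibre-≡ {x = x , p} {y = .x , q} refl = cong (x ,_) (Bool-irrelevant p q)

  -- The bijection writes the indicator of `S` as a sum of `a` point masses, each of total 1.
  ∑-HasSize : ∀ S {a} → HasSize S a → ∑ vs (λ v → ⟦ S v ⟧) ≡ pos a
  ∑-HasSize S {a} size = trans (∑-cong vs (λ v → listed v (S v) refl))
    (trans (∑-swap vs (allFin a) _) (trans (∑-cong (allFin a) λ i →
      trans (∑-cong vs λ v → trans (cong (δ 4) (∣∩∣-comm (proj₁ v) (proj₁ (member i)))) (sym (ℤ.*-identityʳ _)))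
            (∑-vs-δ (member i) (λ _ → 1ℤ)))
      (∑-1 a)))
    where
    open Inverse size
    member : Fin a → V
    member i = proj₁ (from i)
    listed : ∀ v b → S v ≡ b → ⟦ b ⟧ ≡ ∑ (allFin a) λ i → δ 4 (v # member i)
    listed v false v∉S = sym (∑-zero (allFin a) λ i → δ-≢ λ 4≡ →
      contradiction (trans (sym v∉S) (trans (cong S (#≡k⇒≡ v (member i) (sym 4≡))) (proj₂ (from i)))) λ ())
    listed v true v∈S = sym (trans (∑-single (to (v , v∈S)) _ λ j j≢ → δ-≢ λ 4≡ →
        j≢ (trans (sym (strictlyInverseˡ j)) (cong to (fibre-≡ (sym (#≡k⇒≡ v (member j) (sym 4≡)))))))
      (trans (cong (λ w → δ 4 (v # proj₁ w)) (strictlyInverseʳ (v , v∈S))) (cong (δ 4) (#-refl v))))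

  -- Hoffman's ratio bound: independence makes `m 1` vanish, which leaves `b² ≤ 14 * 4 * b`. The
  -- empty set is split off because `b` is cancelled.
  independent-bound : ∀ J b → Independent J → HasSize J b → b ℕ.≤ 56
  independent-bound J zero    ind size = z≤n
  independent-bound J (suc b) ind size = ℤ.drop‿+≤+ (ℤ.*-cancelˡ-≤-pos (pos (suc b)) (pos 56) (pos (suc b)) bound)
    where
    x : V → ℤ
    x v = ⟦ J v ⟧
    s≡ : s x ≡ pos (suc b)
    s≡ = ∑-HasSize J size
    m₀≡s : m x 0 ≡ s x
    m₀≡s = ∑-cong vs λ v → idem (J v)
      where idem : ∀ a → ⟦ a ⟧ * ⟦ a ⟧ ≡ ⟦ a ⟧
            idem true  = refl
            idem false = refl
    term : ∀ v w a b → J v ≡ a → J w ≡ b → ⟦ a ⟧ * (δ 0 (v # w) * ⟦ b ⟧) ≡ 0ℤ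
    term v w false b     _ _ = refl
    term v w true  false _ _ = trans (ℤ.*-identityˡ (δ 0 (v # w) * 0ℤ)) (ℤ.*-zeroʳ (δ 0 (v # w)))
    term v w true  true  p q = cong (λ z → 1ℤ * (z * 1ℤ)) (δ-≢ λ 0≡ →
      ind v w p q (∣∩∣≡0⇒∅ (proj₁ v) (proj₁ w) (sym 0≡)))
    m₁≡0 : m x 1 ≡ 0ℤ
    m₁≡0 = ∑-zero vs λ v → trans (sym (∑-*ˡ vs (x v) _)) (∑-zero vs λ w → term v w (J v) (J w) refl refl)
    lem : ∀ p q r z → p * q ≡ r → p * (0ℤ + q * z) ≡ z * r
    lem p q r z refl = lem₀ p q z
      where lem₀ : ∀ p q z → p * (0ℤ + q * z) ≡ z * (p * q)
            lem₀ = solve-∀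
    bound : pos (suc b) * pos (suc b) ≤ pos (suc b) * pos 56
    bound = subst₂ _≤_ (cong₂ _*_ s≡ s≡)
      (trans (cong₂ (λ y z → pos 14 * (y + pos 4 * z)) m₁≡0 (trans m₀≡s s≡))
        (lem (pos 14) (pos 4) (pos 56) (pos (suc b)) refl))
      (hoffman-bound x)

  module Cut (S : VSet) {c} (f : Remaining S → Fin c)
    (onto : ∀ i → ∃ λ u → f u ≡ i)
    (connected : ∀ u w → Connected S u w → f u ≡ f w) (2≤c : 2 ℕ.≤ c) where

    -- The Boolean comes with its equation because `f` needs the proof that `v` survives; later
    -- proofs can then split on `b`.
    lab : ∀ v b → S v ≡ b → Maybe (Fin c)
    lab v true  _ = nothing
    lab v false e = just (f (v , e))

    label : V → Maybe (Fin c)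
    label v = lab v (S v) refl

    label-just : ∀ v e → label v ≡ just (f (v , e))
    label-just v e = go (S v) refl
      where
      go : ∀ b p → lab v b p ≡ just (f (v , e))
      go true  p = contradiction (trans (sym p) e) λ ()
      go false p = cong (λ q → just (f (v , q))) (Bool-irrelevant p e)

    just-label : ∀ v i → label v ≡ just i → ∃ λ e → f (v , e) ≡ i
    just-label v i = go (S v) refl
      where
      go : ∀ b p → lab v b p ≡ just i → ∃ λ e → f (v , e) ≡ i
      go true  p ()
      go false p eq = p , just-injective eq

    separated : ∀ u w i j → u # w ≡ 0 → label u ≡ just i → label w ≡ just j → i ≡ j
    separated u w i j u#w≡0 u∈i w∈j
      with e , refl ← just-label u i u∈i | e′ , refl ← just-label w j w∈j =
      connected (u , e) (w , e′) (∣∩∣≡0⇒∅ (proj₁ u) (proj₁ w) u#w≡0 ◅ ε)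

    label-onto : ∀ i → ∃ λ v → label v ≡ just i
    label-onto i with (v , e) , refl ← onto i = v , label-just v e

    open Labelled label separated label-onto 2≤c public

    T+∣S∣ : ∀ {a} → HasSize S a → T + pos a ≡ pos 126
    T+∣S∣ {a} ∣S∣ = trans (cong₂ _+_ T≡ (sym (∑-HasSize S ∣S∣))) (trans (sym (∑-+ vs _ _))
      (trans (∑-cong vs λ v → one v (S v) refl) ∑-vs-1))
      where
      T≡ : T ≡ ∑ vs λ v → val (λ _ → 1ℤ) (label v)
      T≡ = trans (∑-swap (allFin c) vs component) (∑-cong vs λ v → sym (trans (val-∑ (λ _ → 1ℤ) (label v))
             (∑-cong (allFin c) λ i → ℤ.*-identityˡ (component i v))))
      one : ∀ v b p → val (λ _ → 1ℤ) (lab v b p) + ⟦ b ⟧ ≡ 1ℤ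
      one v true  p = refl
      one v false p = refl

    4T≡ : ∀ {a} → HasSize S a → pos 4 * T + pos 4 * pos a ≡ pos 504
    4T≡ {a} ∣S∣ = trans (sym (ℤ.*-distribˡ-+ (pos 4) T (pos a))) (cong (pos 4 *_) (T+∣S∣ ∣S∣))

    toughness-bound : ∀ {a} → HasSize S a → 5 ℕ.* c ℕ.≤ 4 ℕ.* a
    toughness-bound {a} ∣S∣ = ℤ.drop‿+≤+ (subst₂ _≤_ (sym (ℤ.pos-* 5 c)) (sym (ℤ.pos-* 4 a))
      (≤-via (lem (pos 4 * T) (pos 5 * pos c) (pos 4 * pos a))
        (ℤ.i≤j⇒0≤j-i (subst (pos 4 * T + pos 5 * pos c ≤_) (sym (4T≡ ∣S∣)) count-bound))))
      where lem : ∀ x y z → z - y ≡ (x + z) - (x + y)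
            lem = solve-∀

    module Tight {a} (∣S∣ : HasSize S a) (tight : 4 ℕ.* a ≡ 5 ℕ.* c) where

      t≡1 : ∀ i → t i ≡ 1ℤ
      t≡1 = tight⇒singletons (trans (cong (pos 4 * T +_)
        (trans (sym (ℤ.pos-* 5 c)) (trans (cong pos (sym tight)) (ℤ.pos-* 4 a)))) (4T≡ ∣S∣))

      -- Single vertices give `T = c`, hence `9 c = 4 c + 5 c = 4 (c + a) = 4 * 126`.
      c≡56 : c ≡ 56
      c≡56 = ℕ.*-cancelˡ-≡ c 56 9 (trans (ℕ.*-distribʳ-+ c 4 5) (trans (cong (4 ℕ.* c ℕ.+_) (sym tight))
        (trans (sym (ℕ.*-distribˡ-+ 4 c a)) (cong (4 ℕ.*_) (ℤ.+-injective
          (trans (ℤ.pos-+ c a) (trans (cong (_+ pos a) (sym (trans (∑-cong (allFin c) t≡1) (∑-1 c)))) (T+∣S∣ ∣S∣))))))))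

      I : VSet
      I v = not (S v)

      I⇒∉S : ∀ {v} → I v ≡ true → S v ≡ false
      I⇒∉S {v} p with false ← S v = refl

      ∉S⇒I : ∀ {v} → S v ≡ false → I v ≡ true
      ∉S⇒I = cong not

      -- An edge would lie inside one class and make its `D` at least 1, but `t = 1` forces `D ≤ 0`
      -- by `edges-≤-pairs`.
      edgeless : ∀ (u w : Remaining S) → ¬ AdjRem S u w
      edgeless (u , e) (w , e′) adj = contradiction
        (ℤ.≤-trans (ℤ.+-monoˡ-≤ (m x 0) 1≤D) (edges-≤-pairs x (0≤component i)))
        (subst₂ (λ a b → ¬ (1ℤ + a ≤ b)) (sym (trans (m₀≡ i) (t≡1 i))) (sym (cong₂ _*_ (t≡1 i) (t≡1 i)))
          λ { (+≤+ (s≤s ())) })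
        where
        i : Fin c
        i = f (u , e)
        x : V → ℤ
        x = component i
        xu≡1 : x u ≡ 1ℤ
        xu≡1 = trans (cong (λ a → χ a i) (label-just u e)) (χ-on i)
        xw≡1 : x w ≡ 1ℤ
        xw≡1 = trans (cong (λ a → χ a i) (trans (label-just w e′)
          (cong just (sym (connected (u , e) (w , e′) (adj ◅ ε)))))) (χ-on i)
        Ax≥0 : ∀ v → 0ℤ ≤ A x v
        Ax≥0 v = ∑-nonneg vs λ z → 0≤* (0≤δ 0 (v # z)) (0≤component i z)
        1≤Ax : 1ℤ ≤ A x u
        1≤Ax = subst (_≤ A x u) (cong₂ _*_ (cong (δ 0) (KAdj⇒#≡0 u w adj)) xw≡1)
          (∑-term (λ z → δ 0 (u # z) * x z) (λ z → 0≤* (0≤δ 0 (u # z)) (0≤component i z)) w)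
        1≤D : 1ℤ ≤ m x 1
        1≤D = ℤ.≤-trans 1≤Ax (subst (_≤ m x 1) (trans (cong (_* A x u) xu≡1) (ℤ.*-identityˡ (A x u)))
          (∑-term (λ v → x v * A x v) (λ v → 0≤* (0≤component i v) (Ax≥0 v)) u))

      -- Equal labels give a path, which is trivial when there are no edges. So `f` itself provides
      -- the bijection showing that `I` has `c` elements.
      injective : ∀ {u w} → (f u ≡ f w → Connected S u w) → f u ≡ f w → u ≡ w
      injective reach fu≡fw with reach fu≡fw
      ... | ε     = refl
      ... | _◅_ {i = u} {j = w} adj _ = contradiction adj (edgeless u w)

  -- The extremal cut: all vertices avoiding a fixed point.

  choose : ℕ → ℕ → ℕ
  choose zero    zero    = 1
  choose zero    (suc k) = 0
  choose (suc n) zero    = choose n zero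
  choose (suc n) (suc k) = choose n k ℕ.+ choose n (suc k)

  KVertex-suc-zero : ∀ {n} → KVertex (suc n) zero ↔ KVertex n zero
  KVertex-suc-zero = mk↔ₛ′ (λ { (true ∷ s , ()) ; (false ∷ s , p) → s , p }) without₀ (λ _ → refl)
    (λ { (true ∷ s , ()) ; (false ∷ s , p) → refl })

  KVertex-suc-suc : ∀ {n k} → KVertex (suc n) (suc k) ↔ (KVertex n k ⊎ KVertex n (suc k))
  KVertex-suc-suc = mk↔ₛ′
    (λ { (true ∷ s , p) → inj₁ (s , ℕ.suc-injective p) ; (false ∷ s , p) → inj₂ (s , p) })
    (λ { (inj₁ v) → with₀ v ; (inj₂ v) → without₀ v })
    (λ { (inj₁ v) → cong inj₁ (KVertex-≡ refl) ; (inj₂ v) → refl })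
    (λ { (true ∷ s , p) → KVertex-≡ refl ; (false ∷ s , p) → refl })

  KVertex-↔ : ∀ n k → KVertex n k ↔ Fin (choose n k)
  KVertex-↔ zero    zero    = mk↔ₛ′ (λ _ → zero) (λ _ → [] , refl) (λ { zero → refl }) (λ { ([] , refl) → refl })
  KVertex-↔ zero    (suc k) = mk↔ₛ′ (λ { ([] , ()) }) (λ ()) (λ ()) (λ { ([] , ()) })
  KVertex-↔ (suc n) zero    = KVertex-↔ n zero ↔-∘ KVertex-suc-zero
  KVertex-↔ (suc n) (suc k) = ↔-sym +↔⊎ ↔-∘ ((KVertex-↔ n k ⊎-↔ KVertex-↔ n (suc k)) ↔-∘ KVertex-suc-suc)

  -- The surviving vertices all contain the first point, so no two are adjacent and each is a
  -- component. There are `choose 8 3 = 56` of them, against `choose 8 4 = 70` deleted ones.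
  star-complement : VSet
  star-complement (b ∷ _ , _) = not b

  star-complement-size : HasSize star-complement 70
  star-complement-size = KVertex-↔ 8 4 ↔-∘ mk↔ₛ′
    (λ { ((false ∷ s , p) , refl) → s , p }) (λ v → without₀ v , refl)
    (λ _ → refl) (λ { ((false ∷ s , p) , refl) → refl })

  star-size : Remaining star-complement ↔ Fin 56
  star-size = KVertex-↔ 8 3 ↔-∘ mk↔ₛ′
    (λ { ((true ∷ s , p) , refl) → s , ℕ.suc-injective p }) (λ v → with₀ v , refl)
    (λ v → KVertex-≡ refl) (λ { ((true ∷ s , p) , refl) → fibre-≡ (KVertex-≡ refl) })

  star-edgeless : ∀ u w → Connected star-complement u w → u ≡ w
  star-edgeless u .u ε = refl
  star-edgeless ((true ∷ _ , _) , refl) w (_◅_ {j = (true ∷ _ , _) , refl} () _)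

  star-cut : CutData star-complement 70 56
  star-cut = star-complement-size ,
    (to , (λ i → from i , strictlyInverseˡ i) , λ u w → mk⇔
      (λ e → subst (Connected star-complement u)
               (trans (sym (strictlyInverseʳ u)) (trans (cong from e) (strictlyInverseʳ w))) ε)
      (λ path → cong to (star-edgeless u w path))) ,
    s≤s (s≤s z≤n)
    where open Inverse star-size

  toughness : ToughnessIs 5 4
  toughness =
    (λ S a c (∣S∣ , (f , onto , f≡⇔) , 2≤c) →
        Cut.toughness-bound S f onto (λ u w → Equivalence.from (f≡⇔ u w)) 2≤c ∣S∣) ,
    star-complement , 70 , 56 , star-cut , refl

  extremal : ∀ S a c → CutData S a c → 4 ℕ.* a ≡ 5 ℕ.* c →
             Σ VSet λ I → MaxIndependent I × IsComplementOf S I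
  extremal S a c (∣S∣ , (f , onto , f≡⇔) , 2≤c) tight =
    I ,
    ((λ u w u∈I w∈I adj → edgeless (u , I⇒∉S u∈I) (w , I⇒∉S w∈I) adj) ,
     c ,
     mk↔ₛ′ (λ (v , v∈I) → f (v , I⇒∉S v∈I))
       (λ i → let ((v , e) , _) = onto i in v , ∉S⇒I e)
       (λ i → let ((v , e) , fv≡i) = onto i in trans (cong (λ p → f (v , p)) (Bool-irrelevant _ e)) fv≡i)
       (λ (v , v∈I) → let (u , fu≡) = onto (f (v , I⇒∉S v∈I)) in
          fibre-≡ (cong proj₁ (injective (Equivalence.to (f≡⇔ u (v , I⇒∉S v∈I))) fu≡))) ,
     λ J b J-ind J-size → subst (b ℕ.≤_) (sym c≡56) (independent-bound J b J-ind J-size)) ,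
    λ v → sym (not-involutive (S v))
    where
    connected : ∀ u w → Connected S u w → f u ≡ f w
    connected u w = Equivalence.from (f≡⇔ u w)
    open Cut S f onto connected 2≤c
    open Tight ∣S∣ tight

theorem27 : let open GraphNotions (KAdj {9} {4}) in
    ToughnessIs 5 4 ×
    ((S : VSet) (m c : ℕ) → CutData S m c → 4 ℕ.* m ≡ 5 ℕ.* c →
    Σ VSet (λ I → MaxIndependent I × IsComplementOf S I))
theorem27 = OddGraph.toughness , OddGraph.extremal
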